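{- In $O(\ell k\log k)$ time one can reduce any instance of the Manhattan Sequence Consensus problem, consisting of $k$ integer sequences of length $\ell$, to an equivalent instance with $k$ integer sequences of length $\ell'$, where $\ell'\le k!$.
   Context: For integer sequences $\mathbf{x}=(x_1,\ldots,x_\ell)$ and $\mathbf{y}=(y_1,\ldots,y_\ell)$ the Manhattan distance is $\mathit{dist}(\mathbf{x},\mathbf{y})=\sum_{j=1}^{\ell}|x_j-y_j|$. The Manhattan Sequence Consensus (MSC) problem: the input is a collection $\mathcal{A}=(\mathbf{a}_1,\ldots,\mathbf{a}_k)$ of $k$ integer sequences of length $\ell$; the output is $\mathrm{OPT}(\mathcal{A})=\min_{\mathbf{x}}\max\{\mathit{dist}(\mathbf{x},\mathbf{a}_i):1\le i\le k\}$, where $\mathbf{x}$ ranges over all integer sequences of length $\ell$, and a minimizing $\mathbf{x}$. Two instances $\mathcal{A},\mathcal{A}'$ are equivalent if $\mathrm{OPT}(\mathcal{A})=\mathrm{OPT}(\mathcal{A}')$. Model of computation: the entries satisfy $|a_{i,j}|\le M$, and $\ell,k,M$ fit in a machine word, so that arithmetic operations (including comparisons) on integers of magnitude $O(\ell M)$ take constant time. In running-time bounds $\log t$ is read as $\max(1,\log_2 t)$. -}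

module Defs where

open import Data.Bool.Base using (if_then_else_)
open import Data.Fin.Base using (Fin; toℕ; fromℕ<; combine; remQuot)
open import Data.Integer.Base as ℤ using (ℤ; +_; -[1+_]; 0ℤ; ∣_∣)
open import Data.Nat.Base using (ℕ; zero; suc; _+_; _*_; _⊔_; _≤_; _≡ᵇ_)
open import Data.Nat.Logarithm using (⌊log₂_⌋)
open import Data.Nat.Properties using (_<?_; +-0-commutativeMonoid)
open import Data.Product.Base using (∃-syntax; _×_; uncurry)
open import Data.Unit.Base using (⊤)
open import Data.Vec.Functional using (Vector; foldr; zipWith)
open import Relation.Binary.PropositionalEquality.Core using (_≡_)
open import Relation.Nullary.Decidable.Core using (yes; no)
open import Relation.Nullary.Negation.Core using (¬_)

open import Algebra.Properties.CommutativeMonoid.Sum +-0-commutativeMonoid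
  using (sum)

------------------------------------------------------------------------
-- Manhattan Sequence Consensus

dist : ∀ {ℓ} → Vector ℤ ℓ → Vector ℤ ℓ → ℕ
dist x y = sum (zipWith (λ a b → ∣ a ℤ.- b ∣) x y)

-- k integer sequences of length ℓ
Instance : ℕ → ℕ → Set
Instance k ℓ = Vector (Vector ℤ ℓ) k

-- Distances are natural numbers, so starting the fold at 0 gives the maximum
-- of every nonempty collection.
maxDist : ∀ {k ℓ} → Vector ℤ ℓ → Instance k ℓ → ℕ
maxDist x A = foldr _⊔_ 0 (λ i → dist x (A i))

-- d = OPT(A): d is the minimum of maxDist x A over all integer sequences x.
IsOPT : ∀ {k ℓ} → Instance k ℓ → ℕ → Set
IsOPT A d = (∃[ x ] maxDist x A ≡ d) × (∀ x → d ≤ maxDist x A)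

-- OPT(A) = OPT(B); the existence of both minima is part of the claim.
Equivalent : ∀ {k ℓ ℓ′} → Instance k ℓ → Instance k ℓ′ → Set
Equivalent A B = ∃[ d ] IsOPT A d × IsOPT B d

------------------------------------------------------------------------
-- Word RAM
--
-- Programs are structured (assignment, branching, loops) over integer
-- variables and unbounded integer arrays with indirect addressing.  A program
-- is a finite syntactic object, so it names finitely many variables and
-- arrays and does not depend on the input.

Name : Set
Name = ℕ

data Op : Set where
  add sub mul div : Op

infix 25 _[_]

data Exp : Set where
  lit  : ℤ → Exp
  var  : Name → Exp
  _[_] : Name → Exp → Exp
  bin  : Op → Exp → Exp → Exp

data Test : Set where
  _≤ᵗ_ _<ᵗ_ _=ᵗ_ : Exp → Exp → Test

infix  20 _≔_ _[_]≔_
infixr 15 _⨾_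

data Cmd : Set where
  skip           : Cmd
  _≔_            : Name → Exp → Cmd
  _[_]≔_         : Name → Exp → Exp → Cmd
  _⨾_            : Cmd → Cmd → Cmd
  ifᶜ_then_else_ : Test → Cmd → Cmd → Cmd
  while_loop_    : Test → Cmd → Cmd

record State : Set where
  constructor state
  field
    vars : Name → ℤ
    arrs : Name → ℕ → ℤ

open State public

update : ∀ {A : Set} → (ℕ → A) → ℕ → A → ℕ → A
update f x v y = if y ≡ᵇ x then v else f y

setVar : State → Name → ℤ → State
setVar s x v = state (update (vars s) x v) (arrs s)

setArr : State → Name → ℕ → ℤ → State
setArr s a p v = state (vars s) (update (arrs s) a (update (arrs s a) p v))

-- Division by zero yields 0.
apply : Op → ℤ → ℤ → ℤ
apply add i j          = i ℤ.+ j
apply sub i j          = i ℤ.- j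
apply mul i j          = i ℤ.* j
apply div i (+ zero)   = 0ℤ
apply div i (+ suc n)  = i ℤ./ (+ suc n)
apply div i (-[1+ n ]) = i ℤ./ -[1+ n ]

-- A negative index is read as its absolute value here, but such an access is
-- ruled out by Fits and by the rule for _[_]≔_.
⟦_⟧ : Exp → State → ℤ
⟦ lit i ⟧     s = i
⟦ var x ⟧     s = vars s x
⟦ a [ e ] ⟧   s = arrs s a ∣ ⟦ e ⟧ s ∣
⟦ bin o e f ⟧ s = apply o (⟦ e ⟧ s) (⟦ f ⟧ s)

Holds : Test → State → Set
Holds (e ≤ᵗ f) s = ⟦ e ⟧ s ℤ.≤ ⟦ f ⟧ s
Holds (e <ᵗ f) s = ⟦ e ⟧ s ℤ.< ⟦ f ⟧ s
Holds (e =ᵗ f) s = ⟦ e ⟧ s ≡ ⟦ f ⟧ s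

-- The value of every subexpression has magnitude at most w, and no array is
-- read at a negative index.
mutual
  Fits : ℕ → Exp → State → Set
  Fits w e s = ∣ ⟦ e ⟧ s ∣ ≤ w × SubFits w e s

  SubFits : ℕ → Exp → State → Set
  SubFits w (lit i)     s = ⊤
  SubFits w (var x)     s = ⊤
  SubFits w (a [ e ])   s = 0ℤ ℤ.≤ ⟦ e ⟧ s × Fits w e s
  SubFits w (bin o e f) s = Fits w e s × Fits w f s

FitsTest : ℕ → Test → State → Set
FitsTest w (e ≤ᵗ f) s = Fits w e s × Fits w f s
FitsTest w (e <ᵗ f) s = Fits w e s × Fits w f s
FitsTest w (e =ᵗ f) s = Fits w e s × Fits w f s

-- One time unit per literal, variable or array access, and operation.
cost : Exp → ℕ
cost (lit i)     = 1
cost (var x)     = 1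
cost (a [ e ])   = 1 + cost e
cost (bin o e f) = 1 + cost e + cost f

costTest : Test → ℕ
costTest (e ≤ᵗ f) = 1 + cost e + cost f
costTest (e <ᵗ f) = 1 + cost e + cost f
costTest (e =ᵗ f) = 1 + cost e + cost f

infix 4 _⊢⟨_,_⟩⇓[_]_

-- w ⊢⟨ P , s ⟩⇓[ t ] s′: started in s, P halts in s′ after t time units, and
-- every integer and address it handles has magnitude at most w.
data _⊢⟨_,_⟩⇓[_]_ (w : ℕ) : Cmd → State → ℕ → State → Set where

  ⇓skip : ∀ {s} → w ⊢⟨ skip , s ⟩⇓[ 1 ] s

  ⇓assign : ∀ {s x e} → Fits w e s →
    w ⊢⟨ x ≔ e , s ⟩⇓[ 1 + cost e ] setVar s x (⟦ e ⟧ s)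

  ⇓store : ∀ {s a e f} → 0ℤ ℤ.≤ ⟦ e ⟧ s → Fits w e s → Fits w f s →
    w ⊢⟨ a [ e ]≔ f , s ⟩⇓[ 1 + cost e + cost f ]
      setArr s a ∣ ⟦ e ⟧ s ∣ (⟦ f ⟧ s)

  ⇓seq : ∀ {s s′ s″ P Q m n} →
    w ⊢⟨ P , s ⟩⇓[ m ] s′ → w ⊢⟨ Q , s′ ⟩⇓[ n ] s″ →
    w ⊢⟨ P ⨾ Q , s ⟩⇓[ m + n ] s″

  ⇓then : ∀ {s s′ b P Q n} → FitsTest w b s → Holds b s →
    w ⊢⟨ P , s ⟩⇓[ n ] s′ →
    w ⊢⟨ ifᶜ b then P else Q , s ⟩⇓[ costTest b + n ] s′

  ⇓else : ∀ {s s′ b P Q n} → FitsTest w b s → ¬ Holds b s →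
    w ⊢⟨ Q , s ⟩⇓[ n ] s′ →
    w ⊢⟨ ifᶜ b then P else Q , s ⟩⇓[ costTest b + n ] s′

  ⇓done : ∀ {s b P} → FitsTest w b s → ¬ Holds b s →
    w ⊢⟨ while b loop P , s ⟩⇓[ costTest b ] s

  ⇓loop : ∀ {s s′ s″ b P m n} → FitsTest w b s → Holds b s →
    w ⊢⟨ P , s ⟩⇓[ m ] s′ → w ⊢⟨ while b loop P , s′ ⟩⇓[ n ] s″ →
    w ⊢⟨ while b loop P , s ⟩⇓[ costTest b + (m + n) ] s″

------------------------------------------------------------------------
-- Input and output conventions: variable 0 holds k, variable 1 holds the
-- length, and array 0 holds the entries in row-major order.

rowMajor : ∀ {k ℓ} → Instance k ℓ → ℕ → ℤ
rowMajor {k} {ℓ} A p with p <? k * ℓ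
... | yes p<kℓ = uncurry A (remQuot ℓ (fromℕ< p<kℓ))
... | no  _    = 0ℤ

input : ∀ {k ℓ} → Instance k ℓ → State
input {k} {ℓ} A = state
  (λ { 0 → + k ; 1 → + ℓ ; _ → 0ℤ })
  (λ { 0 → rowMajor A ; _ → λ _ → 0ℤ })

record Output {k ℓ} (s : State) (A : Instance k ℓ) : Set where
  field
    count   : vars s 0 ≡ + k
    len     : vars s 1 ≡ + ℓ
    entries : ∀ i j → arrs s 0 (toℕ (combine i j)) ≡ A i j

------------------------------------------------------------------------
-- Bounds

-- max(1, log₂ n) up to rounding, which changes it by a factor below 2.
lg : ℕ → ℕ
lg n = 1 ⊔ ⌊log₂ n ⌋

-- The operands of constant-time operations are O(ℓ M) for data and O(ℓ k) for
-- addresses (the input alone occupies ℓ k cells); suc ℓ makes k and M fit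
-- also when ℓ = 0.
wordBound : (k ℓ M : ℕ) → ℕ
wordBound k ℓ M = suc ℓ * (k + M)

{-# OPTIONS --safe #-}
-- If ℓ ≤ k!, the instance is returned unchanged.  Otherwise every column is
-- sorted by binary insertion, and the insertion positions, read in the factorial
-- number system, assign to the column a code n < k! of a sorting permutation.
-- Columns with the same code are added up, and codes that do not occur
-- contribute zero columns, so that the new length is exactly k!.  Adding up
-- preserves OPT because columns sorted by a common permutation are comonotone:
-- any value x for the sum c + d splits as x = y + (x − y) with y − c and
-- (x − y) − d of equal sign in every row.
--
-- The arrangements of all codes are tabulated first, in O(k · k!) ⊆ O(k ℓ) time;
-- with the digit of the last inserted element most significant, a single table
-- of k! rows also serves all the intermediate stages of the insertion.

module Submission where

open import Defs
open import Data.Bool.Base using (true; false)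
open import Data.Fin.Base as Fin using (Fin; toℕ; fromℕ<; combine; remQuot)
open import Data.Fin.Properties using (toℕ<n; fromℕ<-toℕ; toℕ-combine; remQuot-combine)
open import Data.Integer.Base as ℤ using (ℤ; +_; -[1+_]; 0ℤ; ∣_∣)
import Data.Integer.Properties as ℤ
open import Data.Integer.Tactic.RingSolver as ℤ-Ring using ()
open import Data.Nat.Base
open import Data.Nat.Divisibility using (n∣m*n)
open import Data.Nat.DivMod hiding (_div_)
open import Data.Nat.Logarithm
open import Data.Nat.Properties
open import Data.Product.Base using (Σ-syntax; ∃-syntax; _×_; _,_; proj₁; proj₂; uncurry)
open import Data.Sum.Base using (_⊎_; inj₁; inj₂; [_,_]′)
open import Data.Unit.Base using (tt)
open import Data.Vec.Functional using (Vector; foldr; head; tail) renaming ([] to []ᶠ; _∷_ to _∷ᶠ_)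
open import Function.Base using (_∘_; id; _$_)
open import Relation.Binary.Definitions using (tri<; tri≈; tri>)
open import Relation.Binary.PropositionalEquality hiding ([_])
open import Relation.Nullary.Decidable.Core using (Dec; yes; no; map′; _⊎-dec_)
open import Relation.Nullary.Negation.Core using (¬_; contradiction)

open import Algebra.Properties.CommutativeMonoid.Sum +-0-commutativeMonoid using (sum-cong-≗)

-- Manhattan distance and optimal values

-- Binary search needs only O(k log k) comparisons per column, but inserting into an array would
-- still cost quadratically many moves. Here no arrangement is ever moved: the state of the sort is
-- its code, the arrangement is read from the table row of that code, and an insertion is a few
-- arithmetic operations on the code. The final code is at once the index of the output column, so
-- columns with the same permutation meet without any lookup. The word size is the second
-- constraint. Since k! may be far too large for a word, the product is frozen once it reaches ℓ,
-- which still decides whether ℓ ≤ k!. A merged entry is a sum of at most ℓ input entries and so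
-- stays within ℓM. Of the two inequalities between the optima, one is just the triangle inequality;
-- only the splitting of a merged value uses the common order of the columns.

distᴺ : ℕ → (ℕ → ℤ) → (ℕ → ℤ) → ℕ
distᴺ zero    x y = 0
distᴺ (suc n) x y = distᴺ n x y + ∣ x n ℤ.- y n ∣

distᴺ-cong : ∀ n {x x′ y y′} → (∀ j → j < n → x j ≡ x′ j) → (∀ j → j < n → y j ≡ y′ j) →
  distᴺ n x y ≡ distᴺ n x′ y′
distᴺ-cong zero    p q = refl
distᴺ-cong (suc n) p q = cong₂ _+_
  (distᴺ-cong n (λ j → p j ∘ m<n⇒m<1+n) (λ j → q j ∘ m<n⇒m<1+n))
  (cong₂ (λ u v → ∣ u ℤ.- v ∣) (p n ≤-refl) (q n ≤-refl))

-- `dist` sums from the front, whereas `distᴺ` peels off the last index, so that one more column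
-- means one more summand. This bridges the two.
distᴺ-head : ∀ n x y → distᴺ (suc n) x y ≡ ∣ x 0 ℤ.- y 0 ∣ + distᴺ n (x ∘ suc) (y ∘ suc)
distᴺ-head zero    x y = +-comm 0 _
distᴺ-head (suc n) x y = trans
  (cong (λ m → m + ∣ x (suc n) ℤ.- y (suc n) ∣) (distᴺ-head n x y)) (+-assoc ∣ x 0 ℤ.- y 0 ∣ _ _)

dist≡distᴺ : ∀ n x y → dist {n} (x ∘ toℕ) (y ∘ toℕ) ≡ distᴺ n x y
dist≡distᴺ zero    x y = refl
dist≡distᴺ (suc n) x y = trans (cong (λ n → ∣ x 0 ℤ.- y 0 ∣ + n) (dist≡distᴺ n (x ∘ suc) (y ∘ suc)))
  (sym (distᴺ-head n x y))

dist-cong : ∀ {n} {x x′ y y′ : Vector ℤ n} → x ≗ x′ → y ≗ y′ → dist x y ≡ dist x′ y′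
dist-cong p q = sum-cong-≗ (λ j → cong₂ (λ u v → ∣ u ℤ.- v ∣) (p j) (q j))

extend : ∀ {n} → Vector ℤ n → ℕ → ℤ
extend {n} x p with p <? n
... | yes p<n = x (fromℕ< p<n)
... | no  _   = 0ℤ

extend-toℕ : ∀ {n} (x : Vector ℤ n) → extend x ∘ toℕ ≗ x
extend-toℕ {n} x j with toℕ j <? n
... | yes p = cong x (fromℕ<-toℕ j p)
... | no ¬p = contradiction (toℕ<n j) ¬p

-- Both sides carry a term so that no truncated subtraction occurs.
distᴺ-update : ∀ n {x x′ y y′ i} → i < n →
  (∀ j → j < n → j ≢ i → x j ≡ x′ j) → (∀ j → j < n → j ≢ i → y j ≡ y′ j) →
  distᴺ n x y + ∣ x′ i ℤ.- y′ i ∣ ≡ distᴺ n x′ y′ + ∣ x i ℤ.- y i ∣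
distᴺ-update (suc n) {x} {x′} {y} {y′} {i} i<n p q with i ≟ n
... | yes refl
  rewrite distᴺ-cong n {x} {x′} {y} {y′} (λ j j<n → p j (m<n⇒m<1+n j<n) (<⇒≢ j<n))
    (λ j j<n → q j (m<n⇒m<1+n j<n) (<⇒≢ j<n))
  = trans (+-assoc (distᴺ n x′ y′) _ _) (trans
    (cong (λ m → distᴺ n x′ y′ + m) (+-comm ∣ x i ℤ.- y i ∣ _)) (sym (+-assoc (distᴺ n x′ y′) _ _)))
... | no i≢n
  rewrite p n ≤-refl (i≢n ∘ sym) | q n ≤-refl (i≢n ∘ sym)
  = trans (swap (distᴺ n x y) _ _) (trans (cong (_+ ∣ x′ n ℤ.- y′ n ∣)
      (distᴺ-update n (≤∧≢⇒< (≤-pred i<n) i≢n) (λ j → p j ∘ m<n⇒m<1+n) (λ j → q j ∘ m<n⇒m<1+n)))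
    (swap (distᴺ n x′ y′) _ _))
  where
  swap : ∀ a b c → a + b + c ≡ a + c + b
  swap a b c = trans (+-assoc a b c) (trans (cong (λ n → a + n) (+-comm b c)) (sym (+-assoc a c b)))

maximum-mono : ∀ {k} {f g : Vector ℕ k} → (∀ i → f i ≤ g i) → foldr _⊔_ 0 f ≤ foldr _⊔_ 0 g
maximum-mono {zero}  h = z≤n
maximum-mono {suc k} h = ⊔-mono-≤ (h Fin.zero) (maximum-mono (h ∘ Fin.suc))

maxDist-mono : ∀ {k m n} (x : Vector ℤ m) (A : Instance k m) (y : Vector ℤ n) (B : Instance k n) →
  (∀ i → dist x (A i) ≤ dist y (B i)) → maxDist x A ≤ maxDist y B
maxDist-mono x A y B = maximum-mono {f = λ i → dist x (A i)} {g = λ i → dist y (B i)}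

≤maximum : ∀ {k} (f : Vector ℕ k) i → f i ≤ foldr _⊔_ 0 f
≤maximum f Fin.zero    = m≤m⊔n _ _
≤maximum f (Fin.suc i) = ≤-trans (≤maximum (f ∘ Fin.suc) i) (m≤n⊔m (f Fin.zero) _)

any-bounded? : ∀ {P : ℤ → Set} → (∀ z → Dec (P z)) → ∀ b → Dec (∃[ z ] ∣ z ∣ ≤ b × P z)
any-bounded? {P} P? b = map′ to from
  (anyUpTo? (λ n → P? (+ n) ⊎-dec P? (ℤ.- (+ n))) (suc b))
  where
  to : (∃[ n ] n < suc b × (P (+ n) ⊎ P (ℤ.- (+ n)))) → ∃[ z ] ∣ z ∣ ≤ b × P z
  to (n , s≤s n≤b , inj₁ p) = + n , n≤b , p
  to (n , s≤s n≤b , inj₂ p) = ℤ.- (+ n) , subst (_≤ b) (sym (ℤ.∣-i∣≡∣i∣ (+ n))) n≤b , p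
  from : (∃[ z ] ∣ z ∣ ≤ b × P z) → ∃[ n ] n < suc b × (P (+ n) ⊎ P (ℤ.- (+ n)))
  from (+ n , n≤b , p)      = n , s≤s n≤b , inj₁ p
  from (-[1+ n ] , n≤b , p) = suc n , s≤s n≤b , inj₂ p

-- Vectors are functions, and without function extensionality `x` and `head x ∷ᶠ tail x` are equal
-- only pointwise; the exhaustive search therefore asks for predicates that cannot tell them apart.
Respects : ∀ {n} → (Vector ℤ n → Set) → Set
Respects P = ∀ {x y} → x ≗ y → P x → P y

any-vector-bounded? : ∀ n {P : Vector ℤ n → Set} → Respects P → (∀ x → Dec (P x)) →
  ∀ b → Dec (∃[ x ] (∀ j → ∣ x j ∣ ≤ b) × P x)
any-vector-bounded? zero {P} resp P? b = map′
  (λ p → []ᶠ , (λ ()) , p) (λ (x , _ , p) → resp (λ ()) p) (P? []ᶠ)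
any-vector-bounded? (suc n) {P} resp P? b = map′ to from
  (any-bounded? (λ z → any-vector-bounded? n {P ∘ (z ∷ᶠ_)} (λ e → resp (∷-cong e))
    (λ x → P? (z ∷ᶠ x)) b) b)
  where
  ∷-cong : ∀ {z} {x y : Vector ℤ n} → x ≗ y → (z ∷ᶠ x) ≗ (z ∷ᶠ y)
  ∷-cong e Fin.zero    = refl
  ∷-cong e (Fin.suc j) = e j
  η : (x : Vector ℤ (suc n)) → x ≗ (head x ∷ᶠ tail x)
  η x Fin.zero    = refl
  η x (Fin.suc j) = refl
  to : (∃[ z ] ∣ z ∣ ≤ b × (∃[ x ] (∀ j → ∣ x j ∣ ≤ b) × P (z ∷ᶠ x))) → ∃[ x ] (∀ j → ∣ x j ∣ ≤ b) × P x
  to (z , z≤b , x , x≤b , p) = (z ∷ᶠ x) , (λ { Fin.zero → z≤b ; (Fin.suc j) → x≤b j }) , p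
  from : (∃[ x ] (∀ j → ∣ x j ∣ ≤ b) × P x) →
    ∃[ z ] ∣ z ∣ ≤ b × (∃[ x ] (∀ j → ∣ x j ∣ ≤ b) × P (z ∷ᶠ x))
  from (x , x≤b , p) = head x , x≤b Fin.zero , tail x , x≤b ∘ Fin.suc , resp (η x) p

least : ∀ {P : ℕ → Set} → (∀ n → Dec (P n)) → ∀ n → P n → ∃[ d ] P d × (∀ m → P m → d ≤ m)
least P? zero    p = 0 , p , λ _ _ → z≤n
least {P} P? (suc n) p with P? 0
... | yes p₀ = 0 , p₀ , λ _ _ → z≤n
... | no ¬p₀ with least {P ∘ suc} (P? ∘ suc) n p
...   | d , pd , min = suc d , pd , λ { zero q → contradiction q ¬p₀ ; (suc m) q → s≤s (min m q) }

dist-bounds-entries : ∀ {n} (x y : Vector ℤ n) j → ∣ x j ℤ.- y j ∣ ≤ dist x y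
dist-bounds-entries x y Fin.zero    = m≤m+n _ _
dist-bounds-entries x y (Fin.suc j) = ≤-trans (dist-bounds-entries (tail x) (tail y) j)
  (m≤n+m _ ∣ head x ℤ.- head y ∣)

-- A minimiser lies within distance d of the first sequence, so the search for
-- the least feasible d is finite.
opt-exists : ∀ {k ℓ} .{{_ : NonZero k}} (A : Instance k ℓ) → ∃[ d ] IsOPT A d
opt-exists {suc k} {ℓ} A with least feasible? _ ((λ _ → 0ℤ) , ≤-refl)
  where
  bound : ∃[ M ] ∀ j → ∣ A Fin.zero j ∣ ≤ M
  bound = foldr _⊔_ 0 (∣_∣ ∘ A Fin.zero) , ≤maximum (∣_∣ ∘ A Fin.zero)
  near : ∀ {d} x → maxDist x A ≤ d → ∀ j → ∣ x j ∣ ≤ d + proj₁ bound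
  near {d} x p j = begin
    ∣ x j ∣                                       ≡⟨ cong ∣_∣ (x≡x-a+a (x j) (A Fin.zero j)) ⟩
    ∣ (x j ℤ.- A Fin.zero j) ℤ.+ A Fin.zero j ∣   ≤⟨ ℤ.∣i+j∣≤∣i∣+∣j∣ (x j ℤ.- A Fin.zero j) _ ⟩
    ∣ x j ℤ.- A Fin.zero j ∣ + ∣ A Fin.zero j ∣   ≤⟨ +-mono-≤
      (≤-trans (dist-bounds-entries x (A Fin.zero) j)
        (≤-trans (≤maximum (λ i → dist x (A i)) Fin.zero) p)) (proj₂ bound j) ⟩
    d + proj₁ bound                               ∎
    where
    open ≤-Reasoning
    x≡x-a+a : ∀ x a → x ≡ (x ℤ.- a) ℤ.+ a
    x≡x-a+a = ℤ-Ring.solve-∀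
  feasible? : ∀ d → Dec (∃[ x ] maxDist x A ≤ d)
  feasible? d = map′ (λ (x , _ , p) → x , p) (λ (x , p) → x , near x p , p)
    (any-vector-bounded? ℓ (λ {x} {y} e → ≤-trans (maxDist-mono y A x A
        (λ i → ≤-reflexive (dist-cong {y = A i} (sym ∘ e) (λ _ → refl)))))
      (λ x → maxDist x A ≤? d) (d + proj₁ bound))
... | d , (x , p) , min = d , (x , ≤-antisym p (min _ (x , ≤-refl))) , λ y → min _ (y , ≤-refl)

-- A minimum has to be searched for only in `A`: `to` carries a minimiser to a point of `B` with
-- value at most `d`, and `from` shows that no point of `B` goes below `d`.
equivalent : ∀ {k ℓ ℓ′} .{{_ : NonZero k}} (A : Instance k ℓ) (B : Instance k ℓ′) →
  (∀ x → ∃[ y ] ∀ i → dist y (B i) ≤ dist x (A i)) →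
  (∀ y → ∃[ x ] ∀ i → dist x (A i) ≤ dist y (B i)) →
  Equivalent A B
equivalent A B to from with opt-exists A
... | d , (x , refl) , min = d , ((x , refl) , min) ,
  ((proj₁ (to x) , ≤-antisym (maxDist-mono (proj₁ (to x)) B x A (proj₂ (to x)))
    (min′ (proj₁ (to x)))) , min′)
  where
  min′ : ∀ y → d ≤ maxDist y B
  min′ y = ≤-trans (min (proj₁ (from y))) (maxDist-mono (proj₁ (from y)) A y B (proj₂ (from y)))

-- Splitting a value between comonotone columns

-- The largest left endpoint works: it is attained at some `r₀`, so the hypothesis for the pairs
-- `r₀`, `r` puts it below every right endpoint.
helly : ∀ k (lo hi : ℕ → ℤ) → (∀ r r′ → r < k → r′ < k → lo r ℤ.≤ hi r′) →
  ∃[ y ] ∀ r → r < k → lo r ℤ.≤ y × y ℤ.≤ hi r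
helly zero    lo hi h = 0ℤ , λ _ ()
helly (suc k) lo hi h = y , λ r r<k → ub r r<k , subst (ℤ._≤ hi r) (sym eq) (h r₀ r r₀<k r<k)
  where
  sup : ∀ k → ∃[ y ] (∀ r → r < suc k → lo r ℤ.≤ y) × (∃[ r ] r < suc k × y ≡ lo r)
  sup zero = lo 0 , (λ { zero _ → ℤ.≤-refl ; (suc _) (s≤s ()) }) , 0 , ≤-refl , refl
  sup (suc k) with sup k | ℤ.≤-total (lo (suc k)) (proj₁ (sup k))
  ... | y , ub , r , r<k , eq | inj₁ le = y , ub′ , r , m<n⇒m<1+n r<k , eq
    where
    ub′ : ∀ r → r < suc (suc k) → lo r ℤ.≤ y
    ub′ r r<k with m<1+n⇒m<n∨m≡n r<k
    ... | inj₁ r<k  = ub r r<k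
    ... | inj₂ refl = le
  ... | y , ub , _ | inj₂ le = lo (suc k) , ub′ , suc k , ≤-refl , refl
    where
    ub′ : ∀ r → r < suc (suc k) → lo r ℤ.≤ lo (suc k)
    ub′ r r<k with m<1+n⇒m<n∨m≡n r<k
    ... | inj₁ r<k  = ℤ.≤-trans (ub r r<k) le
    ... | inj₂ refl = ℤ.≤-refl
  y = proj₁ (sup k)
  ub = proj₁ (proj₂ (sup k))
  r₀ = proj₁ (proj₂ (proj₂ (sup k)))
  r₀<k = proj₁ (proj₂ (proj₂ (proj₂ (sup k))))
  eq = proj₂ (proj₂ (proj₂ (proj₂ (sup k))))

∣i∣+∣j∣≡∣i+j∣ : ∀ {i j} → 0ℤ ℤ.≤ i → 0ℤ ℤ.≤ j → ∣ i ∣ + ∣ j ∣ ≡ ∣ i ℤ.+ j ∣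
∣i∣+∣j∣≡∣i+j∣ (ℤ.+≤+ _) (ℤ.+≤+ _) = refl

-- Between `c` and `x − d` the differences `y − c` and `(x − y) − d` have the same sign, so their
-- absolute values add. If `x − d ≤ c`, both are negated first.
split-dist : ∀ c d x y → (c ℤ.⊓ (x ℤ.- d)) ℤ.≤ y → y ℤ.≤ (c ℤ.⊔ (x ℤ.- d)) →
  ∣ y ℤ.- c ∣ + ∣ (x ℤ.- y) ℤ.- d ∣ ≡ ∣ x ℤ.- (c ℤ.+ d) ∣
split-dist c d x y lo hi with ℤ.≤-total c (x ℤ.- d)
... | inj₁ c≤ = trans (∣i∣+∣j∣≡∣i+j∣ {y ℤ.- c} {(x ℤ.- y) ℤ.- d}
        (ℤ.i≤j⇒0≤j-i (subst (ℤ._≤ y) (ℤ.i≤j⇒i⊓j≡i c≤) lo))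
        (subst (0ℤ ℤ.≤_) (e₁ x y d) (ℤ.i≤j⇒0≤j-i (subst (y ℤ.≤_) (ℤ.i≤j⇒i⊔j≡j c≤) hi))))
      (cong ∣_∣ (e₂ c d x y))
  where
  e₁ : ∀ x y d → (x ℤ.- d) ℤ.- y ≡ (x ℤ.- y) ℤ.- d
  e₁ = ℤ-Ring.solve-∀
  e₂ : ∀ c d x y → (y ℤ.- c) ℤ.+ ((x ℤ.- y) ℤ.- d) ≡ x ℤ.- (c ℤ.+ d)
  e₂ = ℤ-Ring.solve-∀
... | inj₂ c≥ = trans (cong₂ _+_ (ℤ.∣i-j∣≡∣j-i∣ y c)
  (trans (cong ∣_∣ (e₁ x y d)) (ℤ.∣i-j∣≡∣j-i∣ (x ℤ.- d) y)))
      (trans (∣i∣+∣j∣≡∣i+j∣ {c ℤ.- y} {y ℤ.- (x ℤ.- d)}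
        (ℤ.i≤j⇒0≤j-i (subst (y ℤ.≤_) (ℤ.i≥j⇒i⊔j≡i c≥) hi))
        (ℤ.i≤j⇒0≤j-i (subst (ℤ._≤ y) (ℤ.i≥j⇒i⊓j≡j c≥) lo)))
      (trans (cong ∣_∣ (e₂ c d x y)) (ℤ.∣i-j∣≡∣j-i∣ (c ℤ.+ d) x)))
  where
  e₁ : ∀ x y d → (x ℤ.- y) ℤ.- d ≡ (x ℤ.- d) ℤ.- y
  e₁ = ℤ-Ring.solve-∀
  e₂ : ∀ c d x y → (c ℤ.- y) ℤ.+ (y ℤ.- (x ℤ.- d)) ≡ (c ℤ.+ d) ℤ.- x
  e₂ = ℤ-Ring.solve-∀

-- Phrased for pairs of rows, without a sorting permutation, because Helly's theorem asks only about
-- two intervals at a time.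
Comonotone : ℕ → (ℕ → ℤ) → (ℕ → ℤ) → Set
Comonotone k c d = ∀ r r′ → r < k → r′ < k →
  (c r ℤ.≤ c r′ × d r ℤ.≤ d r′) ⊎ (c r′ ℤ.≤ c r × d r′ ℤ.≤ d r)

-- A point y between c r and x − d r for every r exists by Helly's theorem on
-- the line: comonotonicity makes these intervals intersect pairwise.
comonotone-split : ∀ k c d → Comonotone k c d → ∀ x →
  ∃[ y ] ∀ r → r < k → ∣ y ℤ.- c r ∣ + ∣ (x ℤ.- y) ℤ.- d r ∣ ≡ ∣ x ℤ.- (c r ℤ.+ d r) ∣
comonotone-split k c d co x
  with helly k (λ r → c r ℤ.⊓ (x ℤ.- d r)) (λ r → c r ℤ.⊔ (x ℤ.- d r)) meet
  where
  meet : ∀ r r′ → r < k → r′ < k → (c r ℤ.⊓ (x ℤ.- d r)) ℤ.≤ (c r′ ℤ.⊔ (x ℤ.- d r′))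
  meet r r′ r<k r′<k with co r r′ r<k r′<k
  -- If `c r ≤ c r′`, the minimum and the maximum are compared through `c`; otherwise `d r′ ≤ d r`,
  -- and they are compared through `x − d`.
  ... | inj₁ (c≤ , _) = ℤ.≤-trans (ℤ.i⊓j≤i _ (x ℤ.- d r)) (ℤ.≤-trans c≤ (ℤ.i≤i⊔j _ (x ℤ.- d r′)))
  ... | inj₂ (_ , d≤) = ℤ.≤-trans (ℤ.i⊓j≤j (c r) (x ℤ.- d r))
    (ℤ.≤-trans (ℤ.+-monoʳ-≤ x (ℤ.neg-mono-≤ d≤)) (ℤ.i≤j⊔i (c r′) (x ℤ.- d r′)))
... | y , h = y , λ r r<k → split-dist (c r) (d r) x y (proj₁ (h r r<k)) (proj₂ (h r r<k))

-- Permutations coded in the factorial number system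

-- The element `i` enters an arrangement `f` of the smaller numbers at position `p`. Positions above
-- `i` are reset to the identity rather than shifted, as `perm-step` requires.
insert : ℕ → ℕ → (ℕ → ℕ) → ℕ → ℕ
insert i p f q with <-cmp q p | q ≤? i
... | tri< _ _ _ | _     = f q
... | tri≈ _ _ _ | _     = i
... | tri> _ _ _ | yes _ = f (pred q)
... | tri> _ _ _ | no  _ = q

insert-before : ∀ {i p f q} → q < p → insert i p f q ≡ f q
insert-before {i} {p} {f} {q} q<p with <-cmp q p | q ≤? i
... | tri< _ _ _ | _       = refl
... | tri≈ q≮p _ _ | _     = contradiction q<p q≮p
... | tri> q≮p _ _ | _     = contradiction q<p q≮p

insert-at : ∀ {i p f q} → q ≡ p → insert i p f q ≡ i
insert-at {i} {p} {f} {q} q≡p with <-cmp q p | q ≤? i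
... | tri< _ q≢p _ | _ = contradiction q≡p q≢p
... | tri≈ _ _ _   | _ = refl
... | tri> _ q≢p _ | _ = contradiction q≡p q≢p

insert-after : ∀ {i p f q} → p < q → q ≤ i → insert i p f q ≡ f (pred q)
insert-after {i} {p} {f} {q} p<q q≤i with <-cmp q p | q ≤? i
... | tri< _ _ p≮q | _     = contradiction p<q p≮q
... | tri≈ _ _ p≮q | _     = contradiction p<q p≮q
... | tri> _ _ _ | yes _   = refl
... | tri> _ _ _ | no q≰i  = contradiction q≤i q≰i

insert-beyond : ∀ {i p f q} → p ≤ i → i < q → insert i p f q ≡ q
insert-beyond {i} {p} {f} {q} p≤i i<q with <-cmp q p | q ≤? i
... | tri< _ _ p≮q | _     = contradiction (≤-<-trans p≤i i<q) p≮q
... | tri≈ _ _ p≮q | _     = contradiction (≤-<-trans p≤i i<q) p≮q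
... | tri> _ _ _ | yes q≤i = contradiction i<q (≤⇒≯ q≤i)
... | tri> _ _ _ | no _    = refl

infixl 7 _/!_ _%!_

_/!_ _%!_ : ℕ → ℕ → ℕ
m /! i = _/_ m (i !) {{i !≢0}}
m %! i = _%_ m (i !) {{i !≢0}}

-- perm i m is the arrangement of 0, …, i − 1 with code m = Σ pⱼ j!, where pⱼ
-- of the numbers below j stand to the right of j.  It is continued by the
-- identity, so that codes below i! keep their arrangement as i grows.
perm : ℕ → ℕ → ℕ → ℕ
perm zero    m = id
perm (suc i) m = insert i (i ∸ m /! i) (perm i (m %! i))

pred< : ∀ {p q i} → p < q → q < suc i → pred q < i
pred< {q = suc q} _ (s≤s q<i) = q<i

perm-< : ∀ i m {q} → q < i → perm i m q < i
perm-< (suc i) m {q} q<1+i with <-cmp q (i ∸ m /! i) | q ≤? i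
... | tri< q<p _ _ | _      = m<n⇒m<1+n (perm-< i _ (<-≤-trans q<p (m∸n≤m i (m /! i))))
... | tri≈ _ _ _   | _      = ≤-refl
... | tri> _ _ p<q | yes _  = m<n⇒m<1+n (perm-< i _ (pred< p<q q<1+i))
... | tri> _ _ _   | no q≰i = contradiction (≤-pred q<1+i) q≰i

perm-beyond : ∀ i m {q} → i ≤ q → perm i m q ≡ q
perm-beyond zero    m i≤q = refl
perm-beyond (suc i) m i<q = insert-beyond (m∸n≤m i (m /! i)) i<q

perm-onto : ∀ i m {r} → r < i → ∃[ q ] q < i × perm i m q ≡ r
perm-onto (suc i) m {r} r<1+i with m<1+n⇒m<n∨m≡n r<1+i
... | inj₂ refl = i ∸ m /! i , s≤s (m∸n≤m i (m /! i)) , insert-at {p = i ∸ m /! i} {q = i ∸ m /! i} refl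
... | inj₁ r<i with perm-onto i (m %! i) r<i
...   | q , q<i , eq with q <? i ∸ m /! i
...     | yes q<p = q , m<n⇒m<1+n q<i , trans (insert-before q<p) eq
...     | no  q≮p = suc q , s≤s q<i , trans (insert-after (s≤s (≮⇒≥ q≮p)) q<i) eq

-- The digit of such a code at `i` is 0, so `i` is inserted at position `i`, exactly where the
-- identity tail already has it.
perm-step : ∀ i m → m < i ! → ∀ q → perm (suc i) m q ≡ perm i m q
perm-step i m m<i! q
  rewrite m<n⇒m/n≡0 {{i !≢0}} m<i! | m<n⇒m%n≡m {{i !≢0}} m<i!
  with <-cmp q i | q ≤? i
... | tri< _ _ _    | _       = refl
... | tri≈ _ refl _ | _       = sym (perm-beyond i m ≤-refl)
... | tri> _ _ i<q  | yes q≤i = contradiction i<q (≤⇒≯ q≤i)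
... | tri> _ _ i<q  | no  _   = sym (perm-beyond i m (<⇒≤ i<q))

!-mono-≤′ : ∀ {i k} → i ≤′ k → i ! ≤ k !
!-mono-≤′ ≤′-refl           = ≤-refl
!-mono-≤′ (≤′-step {n} i≤n) = ≤-trans (!-mono-≤′ i≤n) (m≤m+n (n !) (n * n !))

!-mono-≤ : ∀ {i k} → i ≤ k → i ! ≤ k !
!-mono-≤ = !-mono-≤′ ∘ ≤⇒≤′

perm-stable′ : ∀ {i k} m → m < i ! → i ≤′ k → ∀ q → perm k m q ≡ perm i m q
perm-stable′ m m<i! ≤′-refl           q = refl
perm-stable′ m m<i! (≤′-step {k} i≤k) q =
  trans (perm-step k m (<-≤-trans m<i! (!-mono-≤′ i≤k)) q) (perm-stable′ m m<i! i≤k q)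

perm-stable : ∀ {i k} m → m < i ! → i ≤ k → ∀ q → perm k m q ≡ perm i m q
perm-stable m m<i! i≤k = perm-stable′ m m<i! (≤⇒≤′ i≤k)

-- Division with remainder by `i !` recovers `d` and `n`; thus an insertion becomes arithmetic on
-- codes.
perm-insert : ∀ i n d → n < i ! → ∀ q →
  perm (suc i) (n + d * i !) q ≡ insert i (i ∸ d) (perm i n) q
perm-insert i n d n<i! q = cong₂ (λ e m → insert i (i ∸ e) (perm i m) q) quotient remainder
  where
  instance _ = i !≢0
  remainder : (n + d * i !) % i ! ≡ n
  remainder = trans ([m+kn]%n≡m%n n d (i !)) (m<n⇒m%n≡m n<i!)
  quotient : (n + d * i !) / i ! ≡ d
  quotient = trans (+-distrib-/-∣ʳ n (n∣m*n d)) (cong₂ _+_ (m<n⇒m/n≡0 n<i!) (m*n/n≡m d (i !)))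

-- Columns sorted along a permutation, and their merging

SortedAlong : (ℕ → ℕ) → ℕ → (ℕ → ℤ) → Set
SortedAlong f i c = ∀ q q′ → q ≤ q′ → q′ < i → c (f q) ℤ.≤ c (f q′)

sorted-cong : ∀ {f g i c} → (∀ q → f q ≡ g q) → SortedAlong f i c → SortedAlong g i c
sorted-cong {c = c} f≗g h q q′ q≤q′ q′<i =
  subst₂ (λ u v → c u ℤ.≤ c v) (f≗g q) (f≗g q′) (h q q′ q≤q′ q′<i)

sorted-insert : ∀ {f i p} {c : ℕ → ℤ} → p ≤ i → SortedAlong f i c →
  (∀ q → q < p → c (f q) ℤ.≤ c i) → (∀ q → p ≤ q → q < i → c i ℤ.≤ c (f q)) →
  SortedAlong (insert i p f) (suc i) c
sorted-insert {f} {i} {p} {c} p≤i sorted below above q q′ q≤q′ q′<1+i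
  with <-cmp q p | q ≤? i | <-cmp q′ p | q′ ≤? i
... | _ | _ | _ | no q′≰i = contradiction (≤-pred q′<1+i) q′≰i
... | _ | no q≰i | _ | _ = contradiction (≤-trans q≤q′ (≤-pred q′<1+i)) q≰i
... | tri< q<p _ _ | yes _ | tri< q′<p _ _ | yes _ = sorted q q′ q≤q′ (<-≤-trans q′<p p≤i)
... | tri< q<p _ _ | yes _ | tri≈ _ _ _ | yes _ = below q q<p
... | tri< q<p _ _ | yes _ | tri> _ _ p<q′ | yes _ =
  sorted q (pred q′) (≤-trans (<⇒≤ q<p) (≤-pred (≤-trans p<q′ (suc-pred≥ p<q′)))) (pred< p<q′ q′<1+i)
  where
  suc-pred≥ : ∀ {p n} → p < n → n ≤ suc (pred n)
  suc-pred≥ {n = suc n} _ = ≤-refl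
... | tri≈ _ refl _ | yes _ | tri< q′<p _ _ | yes _ = contradiction q≤q′ (<⇒≱ q′<p)
... | tri≈ _ refl _ | yes _ | tri≈ _ _ _ | yes _ = ℤ.≤-refl
... | tri≈ _ refl _ | yes _ | tri> _ _ p<q′ | yes _ = above (pred q′) (<⇒≤pred p<q′) (pred< p<q′ q′<1+i)
... | tri> _ _ p<q | yes _ | tri< q′<p _ _ | yes _ = contradiction (≤-<-trans q≤q′ q′<p) (<-asym p<q)
... | tri> _ _ p<q | yes _ | tri≈ _ refl _ | yes _ = contradiction q≤q′ (<⇒≱ p<q)
... | tri> _ _ p<q | yes _ | tri> _ _ p<q′ | yes _ =
  sorted (pred q) (pred q′) (pred-mono-≤ q≤q′) (pred< p<q′ q′<1+i)

-- Comonotonicity is not transitive: a constant column is comonotone with every other. Hence the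
-- invariant of the merging is sortedness along a fixed permutation, which sums inherit, and
-- comonotonicity is derived from it for each split. Every row has a position, and the order of the
-- positions selects the alternative.
sorted⇒comonotone : ∀ k m {c d} → SortedAlong (perm k m) k c → SortedAlong (perm k m) k d →
  Comonotone k c d
sorted⇒comonotone k m cs ds r r′ r<k r′<k with perm-onto k m r<k | perm-onto k m r′<k
... | q , q<k , refl | q′ , q′<k , refl with ≤-total q q′
...   | inj₁ q≤q′ = inj₁ (cs q q′ q≤q′ q′<k , ds q q′ q≤q′ q′<k)
...   | inj₂ q′≤q = inj₂ (cs q′ q q′≤q q<k , ds q′ q q′≤q q<k)

-- What remains true while the first j columns of a are added, one by one, to
-- the columns of b given by their codes.
record Merged (k F M : ℕ) (a : ℕ → ℕ → ℤ) (j : ℕ) (b : ℕ → ℕ → ℤ) : Set where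
  field
    sorted  : ∀ n → n < F → SortedAlong (perm k n) k (λ r → b r n)
    merge   : ∀ x → ∃[ y ] ∀ r → r < k → distᴺ F y (b r) ≤ distᴺ j x (a r)
    split   : ∀ y → ∃[ x ] ∀ r → r < k → distᴺ j x (a r) ≤ distᴺ F y (b r)
    bounded : ∀ r n → r < k → n < F → ∣ b r n ∣ ≤ j * M

open Merged

distᴺ-zero : ∀ n {x y} → (∀ j → j < n → x j ≡ y j) → distᴺ n x y ≡ 0
distᴺ-zero zero    e = refl
distᴺ-zero (suc n) {x} {y} e = cong₂ _+_ (distᴺ-zero n (λ j → e j ∘ m<n⇒m<1+n))
  (cong ∣_∣ (ℤ.i≡j⇒i-j≡0 (e n ≤-refl)))

merged-empty : ∀ {k F M a b} → (∀ r n → r < k → n < F → b r n ≡ 0ℤ) → Merged k F M a 0 b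
merged-empty {k} b≡0 = record
  { sorted  = λ n n<F q q′ q≤q′ q′<k → ℤ.≤-reflexive
      (trans (b≡0 _ n (perm-< k n (≤-<-trans q≤q′ q′<k)) n<F) (sym (b≡0 _ n (perm-< k n q′<k) n<F)))
  ; merge   = λ x → (λ _ → 0ℤ) , λ r r<k → ≤-reflexive (distᴺ-zero _ λ n n<F → sym (b≡0 r n r<k n<F))
  ; split   = λ y → y , λ r r<k → z≤n
  ; bounded = λ r n r<k n<F → ≤-reflexive (cong ∣_∣ (b≡0 r n r<k n<F))
  }

set : (ℕ → ℤ) → ℕ → ℤ → ℕ → ℤ
set f i z j with j ≟ i
... | yes _ = z
... | no  _ = f j

set-same : ∀ {f} i {z} → set f i z i ≡ z
set-same i with i ≟ i
... | yes _  = refl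
... | no i≢i = contradiction refl i≢i

set-other : ∀ {f i z j} → j ≢ i → set f i z j ≡ f j
set-other {i = i} {j = j} j≢i with j ≟ i
... | yes j≡i = contradiction j≡i j≢i
... | no _    = refl

-- To merge, coordinate `n` grows by `x j`, and the triangle inequality bounds the change. To split,
-- `y n` is divided into `u`, which stays at `n`, and `y n − u`, which goes to the new column; by
-- comonotonicity the two distances add up exactly. Both directions compare the sums after adding a
-- common term, which is then cancelled.
merged-step : ∀ {k F M a b b′ j n} → Merged k F M a j b → n < F →
  SortedAlong (perm k n) k (λ r → a r j) → (∀ r → r < k → ∣ a r j ∣ ≤ M) →
  (∀ r → r < k → b′ r n ≡ b r n ℤ.+ a r j) →
  (∀ r m → r < k → m < F → m ≢ n → b′ r m ≡ b r m) →
  Merged k F M a (suc j) b′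
merged-step {k} {F} {M} {a} {b} {b′} {j} {n} I n<F cs a≤M new old = record
  { sorted  = sorted′
  ; merge   = merge′
  ; split   = split′
  ; bounded = bounded′
  }
  where
  open ≤-Reasoning
  sorted′ : ∀ m → m < F → SortedAlong (perm k m) k (λ r → b′ r m)
  sorted′ m m<F q q′ q≤q′ q′<k with m ≟ n
  ... | yes refl = subst₂ ℤ._≤_ (sym (new _ (perm-< k m (≤-<-trans q≤q′ q′<k))))
    (sym (new _ (perm-< k m q′<k)))
                     (ℤ.+-mono-≤ (sorted I m m<F q q′ q≤q′ q′<k) (cs q q′ q≤q′ q′<k))
  ... | no m≢n   = subst₂ ℤ._≤_ (sym (old _ m (perm-< k m (≤-<-trans q≤q′ q′<k)) m<F m≢n))
    (sym (old _ m (perm-< k m q′<k) m<F m≢n))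
                     (sorted I m m<F q q′ q≤q′ q′<k)
  bounded′ : ∀ r m → r < k → m < F → ∣ b′ r m ∣ ≤ suc j * M
  bounded′ r m r<k m<F with m ≟ n
  ... | yes refl rewrite new r r<k = begin
    ∣ b r m ℤ.+ a r j ∣   ≤⟨ ℤ.∣i+j∣≤∣i∣+∣j∣ (b r m) _ ⟩
    ∣ b r m ∣ + ∣ a r j ∣ ≤⟨ +-mono-≤ (bounded I r m r<k m<F) (a≤M r r<k) ⟩
    j * M + M             ≡⟨ +-comm (j * M) M ⟩
    M + j * M             ∎
  ... | no m≢n rewrite old r m r<k m<F m≢n = ≤-trans (bounded I r m r<k m<F) (m≤n+m _ M)
  merge′ : ∀ x → ∃[ y ] ∀ r → r < k → distᴺ F y (b′ r) ≤ distᴺ (suc j) x (a r)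
  merge′ x with merge I x
  ... | y , h = set y n (y n ℤ.+ x j) , λ r r<k → +-cancelʳ-≤ ∣ y n ℤ.- b r n ∣ _ _ (begin
    distᴺ F y′ (b′ r) + ∣ y n ℤ.- b r n ∣
      ≡⟨ distᴺ-update F n<F (λ m _ m≢n → sym (set-other m≢n)) (λ m m<F m≢n → sym (old r m r<k m<F m≢n)) ⟨
    distᴺ F y (b r) + ∣ y′ n ℤ.- b′ r n ∣
      ≡⟨ cong (λ z → distᴺ F y (b r) + ∣ z ∣)
        (trans (cong₂ ℤ._-_ (set-same n) (new r r<k)) (regroup (y n) (x j) (b r n) (a r j))) ⟩
    distᴺ F y (b r) + ∣ (y n ℤ.- b r n) ℤ.+ (x j ℤ.- a r j) ∣
      ≤⟨ +-mono-≤ (h r r<k) (ℤ.∣i+j∣≤∣i∣+∣j∣ (y n ℤ.- b r n) (x j ℤ.- a r j)) ⟩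
    distᴺ j x (a r) + (∣ y n ℤ.- b r n ∣ + ∣ x j ℤ.- a r j ∣)
      ≡⟨ cong (λ m → distᴺ j x (a r) + m) (+-comm ∣ y n ℤ.- b r n ∣ _) ⟩
    distᴺ j x (a r) + (∣ x j ℤ.- a r j ∣ + ∣ y n ℤ.- b r n ∣)
      ≡⟨ +-assoc (distᴺ j x (a r)) _ _ ⟨
    distᴺ (suc j) x (a r) + ∣ y n ℤ.- b r n ∣ ∎)
    where
    y′ = set y n (y n ℤ.+ x j)
    regroup : ∀ y x b a → (y ℤ.+ x) ℤ.- (b ℤ.+ a) ≡ (y ℤ.- b) ℤ.+ (x ℤ.- a)
    regroup = ℤ-Ring.solve-∀
  split′ : ∀ y → ∃[ x ] ∀ r → r < k → distᴺ (suc j) x (a r) ≤ distᴺ F y (b′ r)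
  split′ y with comonotone-split k (λ r → b r n) (λ r → a r j)
    (sorted⇒comonotone k n (sorted I n n<F) cs) (y n)
  ... | u , hu with split I (set y n u)
  ...   | x , h = set x j v , λ r r<k → +-cancelʳ-≤ ∣ u ℤ.- b r n ∣ _ _ (begin
    distᴺ j (set x j v) (a r) + ∣ set x j v j ℤ.- a r j ∣ + ∣ u ℤ.- b r n ∣
      ≡⟨ cong₂ (λ d z → d + ∣ z ℤ.- a r j ∣ + ∣ u ℤ.- b r n ∣)
        (distᴺ-cong j (λ i i<j → set-other (<⇒≢ i<j)) (λ _ _ → refl)) (set-same j) ⟩
    distᴺ j x (a r) + ∣ v ℤ.- a r j ∣ + ∣ u ℤ.- b r n ∣
      ≤⟨ +-monoˡ-≤ _ (+-monoˡ-≤ _ (h r r<k)) ⟩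
    distᴺ F y′ (b r) + ∣ v ℤ.- a r j ∣ + ∣ u ℤ.- b r n ∣
      ≡⟨ trans (+-assoc (distᴺ F y′ (b r)) _ _)
        (cong (λ m → distᴺ F y′ (b r) + m) (trans (+-comm ∣ v ℤ.- a r j ∣ _) (hu r r<k))) ⟩
    distᴺ F y′ (b r) + ∣ y n ℤ.- (b r n ℤ.+ a r j) ∣
      ≡⟨ cong (λ z → distᴺ F y′ (b r) + ∣ y n ℤ.- z ∣) (new r r<k) ⟨
    distᴺ F y′ (b r) + ∣ y n ℤ.- b′ r n ∣
      ≡⟨ distᴺ-update F n<F (λ m _ m≢n → set-other m≢n) (λ m m<F m≢n → sym (old r m r<k m<F m≢n)) ⟩
    distᴺ F y (b′ r) + ∣ set y n u n ℤ.- b r n ∣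
      ≡⟨ cong (λ z → distᴺ F y (b′ r) + ∣ z ℤ.- b r n ∣) (set-same n) ⟩
    distᴺ F y (b′ r) + ∣ u ℤ.- b r n ∣ ∎)
    where
    v = y n ℤ.- u
    y′ = set y n u

-- Correctness and running time of word RAM programs

update-same : ∀ {A : Set} (f : ℕ → A) x {v} → update f x v x ≡ v
update-same f x with x ≡ᵇ x | ≡⇒≡ᵇ x x refl
... | true | _ = refl

update-other : ∀ {A : Set} (f : ℕ → A) x {v y} → y ≢ x → update f x v y ≡ f y
update-other f x {y = y} y≢x with y ≡ᵇ x | ≡ᵇ⇒≡ y x
... | true  | y≡x = contradiction (y≡x tt) y≢x
... | false | _   = refl

-- The time of a loop-free command (loops are counted as 0).
straight : Cmd → ℕ
straight skip                  = 1
straight (x ≔ e)               = 1 + cost e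
straight (a [ e ]≔ f)          = 1 + cost e + cost f
straight (P ⨾ Q)               = straight P + straight Q
straight (ifᶜ b then P else Q) = costTest b + (straight P ⊔ straight Q)
straight (while b loop P)      = 0

module Logic (w : ℕ) where

  -- Value and word-size obligation travel together, so one symbolic evaluation discharges both.
  record Ev (s : State) (e : Exp) (z : ℤ) : Set where
    constructor ev
    field
      value : ⟦ e ⟧ s ≡ z
      fits  : Fits w e s

  open Ev public

  -- A total-correctness triple from a fixed start state. The exact time is replaced by a budget,
  -- because branches and iterations differ in cost.
  record Runs (P : Cmd) (s : State) (B : ℕ) (Q : State → Set) : Set where
    constructor runs
    field
      {final} : State
      {time}  : ℕ
      run     : w ⊢⟨ P , s ⟩⇓[ time ] final
      time≤   : time ≤ B
      post    : Q final

  open Runs public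

  private
    variable
      s    : State
      e f  : Exp
      P P′ : Cmd
      B B′ : ℕ
      Q R  : State → Set
      m n  : ℕ
      y z  : ℤ

  fit : ⟦ e ⟧ s ≡ z → ∣ z ∣ ≤ w → ∣ ⟦ e ⟧ s ∣ ≤ w
  fit refl z≤w = z≤w

  evLit : ∣ z ∣ ≤ w → Ev s (lit z) z
  evLit z≤w = ev refl (z≤w , tt)

  evVar : ∀ {x} → vars s x ≡ z → ∣ z ∣ ≤ w → Ev s (var x) z
  evVar refl z≤w = ev refl (z≤w , tt)

  evRead : ∀ {a p} → Ev s e (+ p) → arrs s a p ≡ z → ∣ z ∣ ≤ w → Ev s (a [ e ]) z
  evRead {s = s} {e = e} {a = a} (ev v f) refl z≤w = ev eq
    (fit {e = a [ e ]} {s = s} eq z≤w , subst (0ℤ ℤ.≤_) (sym v) (ℤ.+≤+ z≤n) , f)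
    where eq = cong (arrs s a ∘ ∣_∣) v

  evAdd : Ev s e y → Ev s f z → ∣ y ℤ.+ z ∣ ≤ w → Ev s (bin add e f) (y ℤ.+ z)
  evAdd (ev refl f) (ev refl g) ≤w = ev refl (≤w , f , g)

  -- All subtractions of the program are between naturals in this order, so truncated and integer
  -- difference coincide.
  evSub : Ev s e (+ m) → Ev s f (+ n) → n ≤ m → Ev s (bin sub e f) (+ (m ∸ n))
  evSub {s = s} {e = e} {m = m} {f = f} {n = n} (ev v g) (ev v′ g′) n≤m = ev eq
    (fit {e = bin sub e f} {s = s} eq
      (≤-trans (m∸n≤m m n) (subst (λ z → ∣ z ∣ ≤ w) v (proj₁ g))) , g , g′)
    where eq = trans (cong₂ ℤ._-_ v v′) (trans (ℤ.m-n≡m⊖n m n) (ℤ.⊖-≥ n≤m))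

  evMul : Ev s e (+ m) → Ev s f (+ n) → m * n ≤ w → Ev s (bin mul e f) (+ (m * n))
  evMul {s = s} {e = e} {m = m} {f = f} {n = n} (ev v g) (ev v′ g′) ≤w = ev eq
    (fit {e = bin mul e f} {s = s} eq ≤w , g , g′)
    where eq = trans (cong₂ ℤ._*_ v v′) (sym (ℤ.pos-* m n))

  evDiv : .{{_ : NonZero n}} → Ev s e (+ m) → Ev s f (+ n) → Ev s (bin div e f) (+ (m / n))
  evDiv {n = suc n} {s = s} {e = e} {m = m} {f = f} (ev v g) (ev v′ g′) = ev eq
    (fit {e = bin div e f} {s = s} eq
      (≤-trans (m/n≤m m (suc n)) (subst (λ z → ∣ z ∣ ≤ w) v (proj₁ g))) , g , g′)
    where eq = trans (cong₂ (apply div) v v′) (ℤ.*-identityˡ (+ (m / suc n)))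

  weaken : B ≤ B′ → Runs P s B Q → Runs P s B′ Q
  weaken B≤B′ (runs r t q) = runs r (≤-trans t B≤B′) q

  conseq : (∀ {s} → Q s → R s) → Runs P s B Q → Runs P s B R
  conseq h (runs r t q) = runs r t (h q)

  skipᴿ : Q s → Runs skip s 1 Q
  skipᴿ q = runs ⇓skip ≤-refl q

  assign : ∀ {x} → Ev s e z → Q (setVar s x z) → Runs (x ≔ e) s (1 + cost e) Q
  assign (ev refl f) q = runs (⇓assign f) ≤-refl q

  store : ∀ {a p} → Ev s e (+ p) → Ev s f z → Q (setArr s a p z) →
    Runs (a [ e ]≔ f) s (1 + cost e + cost f) Q
  store {s = s} {f = f} {Q = Q} {a = a} (ev v g) (ev refl g′) q = runs
    (⇓store (subst (0ℤ ℤ.≤_) (sym v) (ℤ.+≤+ z≤n)) g g′) ≤-refl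
    (subst (λ i → Q (setArr s a ∣ i ∣ (⟦ f ⟧ s))) (sym v) q)

  infixr 3 _⨾ᴿ_

  _⨾ᴿ_ : Runs P s B Q → (∀ {s} → Q s → Runs P′ s B′ R) → Runs (P ⨾ P′) s (B + B′) R
  runs r t q ⨾ᴿ h = let runs r′ t′ q′ = h q in runs (⇓seq r r′) (+-mono-≤ t t′) q′

  -- The postcondition is itself a run of the remaining program, so a proof joined by `$` follows
  -- the program text.
  step : Runs P s B (λ s → Runs P′ s B′ R) → Runs (P ⨾ P′) s (B + B′) R
  step r = r ⨾ᴿ id

  branch : ∀ {b} → FitsTest w b s → Dec (Holds b s) →
    (Holds b s → Runs P s B Q) → (¬ Holds b s → Runs P′ s B′ Q) →
    Runs (ifᶜ b then P else P′) s (costTest b + (B ⊔ B′)) Q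
  branch {b = b} f (yes h) p p′ = let runs r t q = p h in
    runs (⇓then f h r) (+-monoʳ-≤ (costTest b) (m≤n⇒m≤n⊔o _ t)) q
  branch {b = b} f (no ¬h) p p′ = let runs r t q = p′ ¬h in
    runs (⇓else f ¬h r) (+-monoʳ-≤ (costTest b) (m≤n⇒m≤o⊔n _ t)) q

  branch-≤ : Ev s e y → Ev s f z →
    (y ℤ.≤ z → Runs P s B Q) → (z ℤ.< y → Runs P′ s B′ Q) →
    Runs (ifᶜ e ≤ᵗ f then P else P′) s (1 + cost e + cost f + (B ⊔ B′)) Q
  branch-≤ (ev refl g) (ev refl g′) p p′ = branch (g , g′) (_ ℤ.≤? _) p (p′ ∘ ℤ.≰⇒>)

  branch-< : Ev s e y → Ev s f z →
    (y ℤ.< z → Runs P s B Q) → (z ℤ.≤ y → Runs P′ s B′ Q) →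
    Runs (ifᶜ e <ᵗ f then P else P′) s (1 + cost e + cost f + (B ⊔ B′)) Q
  branch-< (ev refl g) (ev refl g′) p p′ = branch (g , g′) (_ ℤ.<? _) p (p′ ∘ ℤ.≮⇒≥)

  branch-= : Ev s e y → Ev s f z →
    (y ≡ z → Runs P s B Q) → (y ≢ z → Runs P′ s B′ Q) →
    Runs (ifᶜ e =ᵗ f then P else P′) s (1 + cost e + cost f + (B ⊔ B′)) Q
  branch-= (ev refl g) (ev refl g′) p p′ = branch (g , g′) (_ ℤ.≟ _) p p′

  -- The index of `I` bounds the iterations still to come: it must be a successor whenever the test
  -- succeeds. The loop may stop with some of it left, as the binary search does.
  while< : (I : ℕ → State → Set) →
    (∀ {n s} → I n s → ∃[ y ] ∃[ z ] Ev s e y × Ev s f z ×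
      (y ℤ.< z → ∃[ m ] n ≡ suc m × Runs P s B (I m)) × (z ℤ.≤ y → Q s)) →
    ∀ n {s} → I n s →
    Runs (while e <ᵗ f loop P) s (n * (1 + cost e + cost f + B) + (1 + cost e + cost f)) Q
  while< {e = e} {f = f} I step n i with step i
  ... | _ , _ , ev refl g , ev refl g′ , more , done with _ ℤ.<? _
  ...   | no y≮z = runs (⇓done (g , g′) y≮z) (m≤n+m _ (n * _)) (done (ℤ.≮⇒≥ y≮z))
  ...   | yes y<z with more y<z
  ...     | m , refl , runs r t q =
    let runs r′ t′ q′ = while< I step m q in runs (⇓loop (g , g′) y<z r r′) (bound t t′) q′
    where
    ct = 1 + cost e + cost f
    bound : ∀ {x y B C} → x ≤ B → y ≤ C + ct → ct + (x + y) ≤ ct + B + C + ct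
    bound {x} {y} {B} {C} x≤ y≤ = begin
      ct + (x + y)        ≤⟨ +-monoʳ-≤ ct (+-mono-≤ x≤ y≤) ⟩
      ct + (B + (C + ct)) ≡⟨ cong (λ n → ct + n) (+-assoc B C ct) ⟨
      ct + (B + C + ct)   ≡⟨ +-assoc ct (B + C) ct ⟨
      ct + (B + C) + ct   ≡⟨ cong (λ n → n + ct) (+-assoc ct B C) ⟨
      ct + B + C + ct     ∎
      where open ≤-Reasoning

  for : ∀ N (J : ℕ → State → Set) →
    (∀ {i s} → i ≤ N → J i s → Ev s e (+ i) × Ev s f (+ N)) →
    (∀ {i s} → i < N → J i s → Runs P s B (J (suc i))) →
    ∀ i {s} → i ≤ N → J i s →
    Runs (while e <ᵗ f loop P) s ((N ∸ i) * (1 + cost e + cost f + B) + (1 + cost e + cost f)) (J N)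
  for {e = e} {f = f} {P = P} {B = B} N J evs body i i≤N start =
    while< I iterate (N ∸ i) (i , i≤N , refl , start)
    where
    I : ℕ → State → Set
    I n s = ∃[ i ] i ≤ N × n ≡ N ∸ i × J i s
    iterate : ∀ {n s} → I n s → ∃[ y ] ∃[ z ] Ev s e y × Ev s f z ×
      (y ℤ.< z → ∃[ m ] n ≡ suc m × Runs P s B (I m)) × (z ℤ.≤ y → J N s)
    iterate {s = s} (i , i≤N , refl , j) = + i , + N , proj₁ (evs i≤N j) , proj₂ (evs i≤N j) ,
      (λ { (ℤ.+<+ i<N) → N ∸ suc i , sym (suc-pred-∸ i<N) ,
            conseq (λ q → suc i , i<N , refl , q) (body i<N j) }) ,
      (λ { (ℤ.+≤+ N≤i) → subst (λ i → J i s) (≤-antisym i≤N N≤i) j })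
      where
      suc-pred-∸ : ∀ {i N} → i < N → suc (N ∸ suc i) ≡ N ∸ i
      suc-pred-∸ i<N = sym (+-∸-assoc 1 i<N)

-- The program
--
-- Variables 0, 1 and 2 hold k, ℓ and k!.  While the table (array 1) is filled,
-- 3 is the position in row 4, whose last inserted element is 5; 6 is the
-- factorial of 5, 7 the position of that element, and 8 the row without it.
-- While columns are sorted and added to array 2, 3 is the row and 4 the column;
-- 5 is the factorial of 3, 6 the code so far, and the binary search interval
-- starts at variable 7 and has the length given by variable 8.

one+ : Exp → Exp
one+ = bin add (lit (+ 1))

increment : Name → Cmd
increment x = x ≔ one+ (var x)

factorialStep factorial : Cmd
factorialStep =
  increment 3 ⨾
  -- Freezing the product at the first value that reaches the length keeps it within a word.
  (ifᶜ var 2 <ᵗ var 1 then 2 ≔ bin mul (var 3) (var 2) else skip)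
factorial =
  2 ≔ lit (+ 1) ⨾
  3 ≔ lit (+ 0) ⨾
  (while var 3 <ᵗ var 0 loop factorialStep)

cell entry : Exp → Exp → Exp
cell n q = bin add (bin mul (var 0) n) q
entry r j = bin add (bin mul (var 1) r) j

identityStep identityRow chooseCell insertStep insertHeader insertRow table : Cmd
identityStep =
  1 [ var 3 ]≔ var 3 ⨾
  increment 3
identityRow =
  3 ≔ lit (+ 0) ⨾
  (while var 3 <ᵗ var 0 loop identityStep)
chooseCell =
  ifᶜ var 3 <ᵗ var 7 then 9 ≔ 1 [ cell (var 8) (var 3) ] else (
  ifᶜ var 3 =ᵗ var 7 then 9 ≔ var 5 else (
  ifᶜ var 3 ≤ᵗ var 5 then 9 ≔ 1 [ cell (var 8) (bin sub (var 3) (lit (+ 1))) ] else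
  (9 ≔ var 3)))
insertStep =
  chooseCell ⨾
  1 [ cell (var 4) (var 3) ]≔ var 9 ⨾
  increment 3
insertHeader =
  (ifᶜ bin mul (one+ (var 5)) (var 6) ≤ᵗ var 4
    then (6 ≔ bin mul (one+ (var 5)) (var 6) ⨾ increment 5) else skip) ⨾
  7 ≔ bin div (var 4) (var 6) ⨾
  8 ≔ bin sub (var 4) (bin mul (var 7) (var 6)) ⨾
  7 ≔ bin sub (var 5) (var 7) ⨾
  3 ≔ lit (+ 0)
insertRow =
  insertHeader ⨾
  (while var 3 <ᵗ var 0 loop insertStep) ⨾
  increment 4
table =
  identityRow ⨾
  4 ≔ lit (+ 1) ⨾
  5 ≔ lit (+ 1) ⨾
  6 ≔ lit (+ 1) ⨾
  (while var 4 <ᵗ var 2 loop insertRow)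

searchStep search insertEntry sortColumn addStep addColumn column columns copyStep copy reduce : Cmd
searchStep =
  9 ≔ bin div (var 8) (lit (+ 2)) ⨾
  (ifᶜ 0 [ entry (1 [ cell (var 6) (bin add (var 7) (var 9)) ]) (var 4) ] ≤ᵗ 0 [ entry (var 3) (var 4) ]
    then (7 ≔ bin add (var 7) (one+ (var 9)) ⨾ 8 ≔ bin sub (var 8) (one+ (var 9)))
    else (8 ≔ var 9))
search =
  7 ≔ lit (+ 0) ⨾
  8 ≔ var 3 ⨾
  (while lit (+ 0) <ᵗ var 8 loop searchStep)
insertEntry =
  search ⨾
  -- The new digit is the number of earlier elements to the right of the insertion position.
  6 ≔ bin add (var 6) (bin mul (bin sub (var 3) (var 7)) (var 5)) ⨾
  increment 3 ⨾
  5 ≔ bin mul (var 3) (var 5)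
sortColumn =
  3 ≔ lit (+ 0) ⨾
  5 ≔ lit (+ 1) ⨾
  6 ≔ lit (+ 0) ⨾
  (while var 3 <ᵗ var 0 loop insertEntry)
addStep =
  2 [ bin add (bin mul (var 2) (var 3)) (var 6) ]≔
    bin add (2 [ bin add (bin mul (var 2) (var 3)) (var 6) ]) (0 [ entry (var 3) (var 4) ]) ⨾
  increment 3
addColumn =
  3 ≔ lit (+ 0) ⨾
  (while var 3 <ᵗ var 0 loop addStep)
column =
  sortColumn ⨾
  addColumn ⨾
  increment 4
columns =
  4 ≔ lit (+ 0) ⨾
  (while var 4 <ᵗ var 1 loop column)
copyStep =
  0 [ var 3 ]≔ 2 [ var 3 ] ⨾
  increment 3
copy =
  3 ≔ lit (+ 0) ⨾
  (while var 3 <ᵗ bin mul (var 0) (var 2) loop copyStep) ⨾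
  1 ≔ var 2
reduce =
  -- For length 0 the time budget is constant and does not pay for the loop computing the factorial.
  -- Since 1 ≤ k!, lengths up to 1 can be returned at once.
  ifᶜ var 1 ≤ᵗ lit (+ 1) then skip else (
  factorial ⨾
  (ifᶜ var 1 ≤ᵗ var 2 then skip else (
  table ⨾
  columns ⨾
  copy)))

-- Verification of the program

n<2^[1+⌊log₂n⌋] : ∀ n → n < 2 ^ suc ⌊log₂ n ⌋
n<2^[1+⌊log₂n⌋] n = ≰⇒> λ 2^≤n → contradiction
  (subst (_≤ ⌊log₂ n ⌋) (⌊log₂[2^n]⌋≡n (suc ⌊log₂ n ⌋)) (⌊log₂⌋-mono-≤ 2^≤n)) 1+n≰n

flat< : ∀ {k n q N} → n < N → q < k → k * n + q < k * N
flat< {k} {n} {q} {N} n<N q<k = begin-strict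
  k * n + q <⟨ +-monoʳ-< (k * n) q<k ⟩
  k * n + k ≡⟨ +-comm (k * n) k ⟩
  k + k * n ≡⟨ *-suc k n ⟨
  k * suc n ≤⟨ *-monoʳ-≤ k n<N ⟩
  k * N     ∎
  where open ≤-Reasoning

flat-/ : ∀ k n {q} .{{_ : NonZero k}} → q < k → (k * n + q) / k ≡ n
flat-/ k n {q} q<k = trans (/-congˡ (trans (+-comm (k * n) q) (cong (λ m → q + m) (*-comm k n))))
  (trans (+-distrib-/-∣ʳ q (n∣m*n n)) (cong₂ _+_ (m<n⇒m/n≡0 q<k) (m*n/n≡m n k)))

flat-% : ∀ k n {q} .{{_ : NonZero k}} → q < k → (k * n + q) % k ≡ q
flat-% k n {q} q<k = trans (%-congˡ (trans (+-comm (k * n) q) (cong (λ m → q + m) (*-comm k n))))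
  (trans ([m+kn]%n≡m%n q n k) (m<n⇒m%n≡m q<k))

module Correctness (k ℓ M : ℕ) .{{_ : NonZero k}} (a : ℕ → ℤ) (a≤M : ∀ p → ∣ a p ∣ ≤ M)
  (1<ℓ : 1 < ℓ) (w : ℕ) (ℓk≤w : ℓ * k ≤ w) (ℓM≤w : ℓ * M ≤ w) where

  open Logic w

  instance
    ℓ≢0 : NonZero ℓ
    ℓ≢0 = >-nonZero (<-trans z<s 1<ℓ)

  k≤ℓk : k ≤ ℓ * k
  k≤ℓk = m≤n*m k ℓ

  ℓ≤ℓk : ℓ ≤ ℓ * k
  ℓ≤ℓk = m≤m*n ℓ k

  k≤w : k ≤ w
  k≤w = ≤-trans k≤ℓk ℓk≤w

  ℓ≤w : ℓ ≤ w
  ℓ≤w = ≤-trans ℓ≤ℓk ℓk≤w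

  2≤w : 2 ≤ w
  2≤w = ≤-trans 1<ℓ ℓ≤w

  1≤w : 1 ≤ w
  1≤w = ≤-trans (s≤s z≤n) 2≤w

  a≤w : ∀ p → ∣ a p ∣ ≤ w
  a≤w p = ≤-trans (a≤M p) (≤-trans (m≤n*m M ℓ) ℓM≤w)

  evOne+ : ∀ {s e n} → Ev s e (+ n) → suc n ≤ w → Ev s (one+ e) (+ suc n)
  evOne+ e = evAdd (evLit 1≤w) e

  incr : ∀ {s x n} {Q : State → Set} → vars s x ≡ + n → suc n ≤ w →
    Q (setVar s x (+ suc n)) → Runs (increment x) s 4 Q
  incr e ≤w = assign (evOne+ (evVar e (≤-trans (n≤1+n _) ≤w)) ≤w)

  Arrays : (T b : ℕ → ℤ) → State → Set
  Arrays T b s = arrs s 0 ≡ a × arrs s 1 ≡ T × arrs s 2 ≡ b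

  Fact : (T b : ℕ → ℤ) → ℕ → State → Set
  Fact T b i s = vars s 0 ≡ + k × vars s 1 ≡ + ℓ × vars s 3 ≡ + i × Arrays T b s ×
    ∃[ f ] vars s 2 ≡ + f × f ≤ i ! × (f ≡ i ! ⊎ ℓ ≤ f) × f ≤ ℓ * k

  factorialStep-runs : ∀ {T b i s} → i < k → Fact T b i s →
    Runs factorialStep s (straight factorialStep) (Fact T b (suc i))
  factorialStep-runs {i = i} i<k (e0 , e1 , e3 , A , f , e2 , f≤ , exact , small) =
    step $ incr e3 (≤-trans i<k k≤w) $
    branch-< (evVar e2 (≤-trans small ℓk≤w)) (evVar e1 ℓ≤w)
      (λ { (ℤ.+<+ f<ℓ) → assign
          (evMul (evVar refl (≤-trans i<k k≤w)) (evVar e2 (≤-trans small ℓk≤w))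
            (≤-trans (new-small f<ℓ) ℓk≤w))
          (e0 , e1 , refl , A , suc i * f , refl , *-monoʳ-≤ (suc i) f≤ ,
            [ (λ eq → inj₁ (cong (λ g → suc i * g) eq)) ,
              (λ ℓ≤f → contradiction f<ℓ (≤⇒≯ ℓ≤f)) ]′ exact ,
            new-small f<ℓ) })
      (λ { (ℤ.+≤+ ℓ≤f) → skipᴿ (e0 , e1 , refl , A , f , e2 , ≤-trans f≤ (m≤m+n (i !) _) ,
        inj₂ ℓ≤f , small) })
    where
    new-small : f < ℓ → suc i * f ≤ ℓ * k
    new-small f<ℓ = ≤-trans (*-mono-≤ i<k (<⇒≤ f<ℓ)) (≤-reflexive (*-comm k ℓ))

  factorial-runs : ∀ {T b s} → vars s 0 ≡ + k → vars s 1 ≡ + ℓ → Arrays T b s →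
    Runs factorial s (4 + (k * (3 + straight factorialStep) + 3)) (Fact T b k)
  factorial-runs {T} {b} e0 e1 A =
    step $ assign (evLit 1≤w) $ step $ assign (evLit z≤n) $
    for k (Fact T b) (λ i≤k (e0 , _ , e3 , _) → evVar e3 (≤-trans i≤k k≤w) ,
      evVar e0 k≤w) factorialStep-runs 0 z≤n
      (e0 , e1 , refl , A , 1 , refl , ≤-refl , inj₁ refl , ≤-trans (>-nonZero⁻¹ ℓ) ℓ≤ℓk)

  module Large (k!<ℓ : k ! < ℓ) where

    F : ℕ
    F = k !

    F≤w : F ≤ w
    F≤w = ≤-trans (<⇒≤ k!<ℓ) ℓ≤w

    flat≤w : ∀ {n q} → n < ℓ → q < k → k * n + q ≤ w
    flat≤w n<ℓ q<k = ≤-trans (<⇒≤ (flat< n<ℓ q<k)) (≤-trans (≤-reflexive (*-comm k ℓ)) ℓk≤w)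

    tableEntry : ℕ → ℤ
    tableEntry p = + perm k (p / k) (p % k)

    tableEntry-flat : ∀ n {q} → q < k → tableEntry (k * n + q) ≡ + perm k n q
    tableEntry-flat n q<k = cong +_ (cong₂ (perm k) (flat-/ k n q<k) (flat-% k n q<k))

    Filled : (ℕ → ℤ) → ℕ → Set
    Filled T N = ∀ p → p < N → T p ≡ tableEntry p

    filled-suc : ∀ {T N z} → Filled T N → z ≡ tableEntry N → Filled (update T N z) (suc N)
    filled-suc {T} {N} h refl p p<1+N with m<1+n⇒m<n∨m≡n p<1+N
    ... | inj₂ refl = update-same T N
    ... | inj₁ p<N  = trans (update-other T N (<⇒≢ p<N)) (h p p<N)

    Common : (ℕ → ℤ) → State → Set
    Common b s = vars s 0 ≡ + k × vars s 1 ≡ + ℓ × vars s 2 ≡ + F × arrs s 0 ≡ a × arrs s 2 ≡ b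

    evCell : ∀ {s e f n q} → vars s 0 ≡ + k → Ev s e (+ n) → Ev s f (+ q) → n < ℓ → q < k →
      Ev s (cell e f) (+ (k * n + q))
    evCell {n = n} {q} e0 e f n<ℓ q<k =
      evAdd (evMul (evVar e0 k≤w) e (≤-trans (m≤m+n (k * n) q) (flat≤w n<ℓ q<k))) f (flat≤w n<ℓ q<k)

    IdentityRow : (ℕ → ℤ) → ℕ → State → Set
    IdentityRow b q s = Common b s × vars s 3 ≡ + q × Filled (arrs s 1) q

    identityStep-runs : ∀ {b q s} → q < k → IdentityRow b q s →
      Runs identityStep s (straight identityStep) (IdentityRow b (suc q))
    identityStep-runs {q = q} q<k (c , e3 , h) =
      step $ store (evVar e3 q≤w) (evVar e3 q≤w) $ incr e3 (≤-trans q<k k≤w)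
        (c , refl , filled-suc h (cong +_
          (sym (trans (cong₂ (perm k) (m<n⇒m/n≡0 q<k) (m<n⇒m%n≡m q<k))
            (perm-stable {0} {k} 0 z<s z≤n q)))))
      where q≤w = ≤-trans (<⇒≤ q<k) k≤w

    identityRow-runs : ∀ {b s} → Common b s →
      Runs identityRow s (2 + (k * (3 + straight identityStep) + 3)) (IdentityRow b k)
    identityRow-runs {b} c = step $ assign (evLit z≤n) $
      for k (IdentityRow b) (λ q≤k ((e0 , _) , e3 , _) → evVar e3 (≤-trans q≤k k≤w) , evVar e0 k≤w)
        identityStep-runs 0 z≤n (c , refl , λ _ ())

    Row : (ℕ → ℤ) → (m i q : ℕ) → State → Set
    Row b m i q s = Common b s × vars s 3 ≡ + q × vars s 4 ≡ + m × vars s 5 ≡ + i × vars s 6 ≡ + (i !) ×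
      vars s 7 ≡ + (i ∸ m /! i) × vars s 8 ≡ + (m %! i) × Filled (arrs s 1) (k * m + q)

    -- Row m is obtained by inserting i into row m %! i < m, which is already in
    -- the table.
    module _ {m i} (i!≤m : i ! ≤ m) (m<[1+i]! : m < suc i !) (m<F : m < F) where

      m<ℓ : m < ℓ
      m<ℓ = <-trans m<F k!<ℓ

      i<k : i < k
      i<k = ≰⇒> λ k≤i → contradiction (≤-trans (!-mono-≤ k≤i) i!≤m) (<⇒≱ m<F)

      parent< : m %! i < i !
      parent< = m%n<n m (i !) {{i !≢0}}

      parent<m : m %! i < m
      parent<m = <-≤-trans parent< i!≤m

      perm-row : ∀ q → perm k m q ≡ insert i (i ∸ m /! i) (perm i (m %! i)) q
      perm-row = perm-stable m m<[1+i]! i<k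

      chooseCell-runs : ∀ {b q s} → q < k → Row b m i q s →
        Runs chooseCell s (straight chooseCell) (λ s → Row b m i q s × vars s 9 ≡ + perm k m q)
      chooseCell-runs {b} {q} {s} q<k R@(c@(e0 , _) , e3 , e4 , e5 , e6 , e7 , e8 , h) =
        branch-< ev3 ev7
          (λ { (ℤ.+<+ q<p) → assign (readParent ev3 q<k ≤-refl)
            (R , cong +_ (sym (trans (perm-row q) (trans (insert-before q<p) (parentEntry q))))) })
          λ { (ℤ.+≤+ p≤q) → branch-= ev3 ev7
            (λ q≡p → assign ev5 (R , cong +_ (sym (trans (perm-row q) (insert-at (ℤ.+-injective q≡p))))))
            λ q≢p → let p<q = ≤∧≢⇒< p≤q (q≢p ∘ cong +_ ∘ sym) in branch-≤ ev3 ev5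
              (λ { (ℤ.+≤+ q≤i) → assign
                (readParent (evSub ev3 (evLit 1≤w) (≤-trans (s≤s z≤n) p<q))
                  (≤-<-trans (m∸n≤m q 1) q<k) (m∸n≤m q 1))
                (R , cong +_ (sym (trans (perm-row q)
                  (trans (insert-after p<q q≤i) (parentEntry (q ∸ 1)))))) })
              λ { (ℤ.+<+ i<q) → assign ev3
                (R , cong +_ (sym (trans (perm-row q) (insert-beyond (m∸n≤m i (m /! i)) i<q)))) } }
        where
        ev3 = evVar {s = s} e3 (≤-trans (<⇒≤ q<k) k≤w)
        ev5 = evVar {s = s} e5 (≤-trans (<⇒≤ i<k) k≤w)
        ev7 = evVar {s = s} e7 (≤-trans (≤-trans (m∸n≤m i (m /! i)) (<⇒≤ i<k)) k≤w)
        parentEntry : ∀ q → perm i (m %! i) q ≡ perm k (m %! i) q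
        parentEntry q = sym (perm-stable (m %! i) parent< (<⇒≤ i<k) q)
        readParent : ∀ {e q′} → Ev s e (+ q′) → q′ < k → q′ ≤ q →
          Ev s (1 [ cell (var 8) e ]) (+ perm k (m %! i) q′)
        readParent {q′ = q′} e q′<k q′≤q = evRead
          (evCell e0 (evVar e8 (≤-trans (<⇒≤ (<-trans parent<m m<ℓ)) ℓ≤w)) e (<-trans parent<m m<ℓ) q′<k)
          (trans (h _ (<-≤-trans (flat< parent<m q′<k) (m≤m+n (k * m) q)))
            (tableEntry-flat (m %! i) q′<k))
          (≤-trans (<⇒≤ (perm-< k (m %! i) q′<k)) k≤w)

      insertStep-runs : ∀ {b q s} → q < k → Row b m i q s →
        Runs insertStep s (straight insertStep) (Row b m i (suc q))
      insertStep-runs {q = q} q<k R = chooseCell-runs q<k R ⨾ᴿ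
        λ { ((c@(e0 , _) , e3 , e4 , e5 , e6 , e7 , e8 , h) , e9) →
          step $ store
            (evCell e0 (evVar e4 (≤-trans (<⇒≤ m<ℓ) ℓ≤w)) (evVar e3 (≤-trans (<⇒≤ q<k) k≤w)) m<ℓ q<k)
            (evVar e9 (≤-trans (<⇒≤ (perm-< k m q<k)) k≤w)) $
          incr e3 (≤-trans q<k k≤w)
            (c , refl , e4 , e5 , e6 , e7 , e8 ,
             λ p p< → filled-suc h (sym (tableEntry-flat m q<k)) p
               (subst (λ n → p < n) (+-suc (k * m) q) p<)) }

    -- The upper bound on `m` is not strict: on reaching `suc i !` the stage `i` advances only in
    -- the header of the next row.
    Table : (ℕ → ℤ) → ℕ → State → Set
    Table b m s = Common b s × vars s 4 ≡ + m ×
      (∃[ i ] vars s 5 ≡ + i × vars s 6 ≡ + (i !) × i ! ≤ m × m ≤ suc i !) ×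
      Filled (arrs s 1) (k * m)

    insertHeader-runs : ∀ {b m s} → m < F → Table b m s →
      Runs insertHeader s (straight insertHeader) (λ s → ∃[ i ] i ! ≤ m × m < suc i ! × Row b m i 0 s)
    insertHeader-runs {b} {m} {s} m<F (c , e4 , (i , e5 , e6 , i!≤m , m≤[1+i]!) , h) = advance ⨾ᴿ
      λ { {s} (i , i!≤m , m<[1+i]! , c@(_ , _ , _) , e4 , e5 , e6 , h) →
        let instance _ = i !≢0
            m≤w : m ≤ w
            m≤w = ≤-trans (<⇒≤ m<F) F≤w
            ev4 : ∀ {s} → vars s 4 ≡ + m → Ev s (var 4) (+ m)
            ev4 = λ e → evVar e m≤w
            ev6 : ∀ {s} → vars s 6 ≡ + (i !) → Ev s (var 6) (+ (i !))
            ev6 = λ e → evVar e (≤-trans i!≤m m≤w)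
            d≤i : m / i ! ≤ i
            d≤i = ≤-pred (m<n*o⇒m/o<n m<[1+i]!)
            i≤w : i ≤ w
            i≤w = ≤-trans (<⇒≤ (i<k i!≤m m<[1+i]! m<F)) k≤w
        in
        step $ assign (evDiv (ev4 e4) (ev6 e6)) $
        step $ assign (evSub (ev4 e4) (evMul (evVar refl (≤-trans (m/n≤m m (i !)) m≤w)) (ev6 e6)
                 (≤-trans (m/n*n≤m m (i !)) m≤w)) (m/n*n≤m m (i !))) $
        step $ assign (evSub (evVar e5 i≤w) (evVar refl (≤-trans d≤i i≤w)) d≤i) $
        assign (evLit z≤n)
          (i , i!≤m , m<[1+i]! , c , refl , e4 , e5 , e6 , refl ,
           cong +_ (sym (m%n≡m∸m/n*n m (i !))) ,
             subst (Filled (arrs s 1)) (sym (+-identityʳ (k * m))) h) }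
      where
      Advanced : State → Set
      Advanced s = ∃[ i ] i ! ≤ m × m < suc i ! × Common b s × vars s 4 ≡ + m × vars s 5 ≡ + i ×
        vars s 6 ≡ + (i !) × Filled (arrs s 1) (k * m)
      m<ℓ′ = <-trans m<F k!<ℓ
      i<k′ : i < k
      i<k′ = ≰⇒> λ k≤i → contradiction (≤-trans (!-mono-≤ k≤i) i!≤m) (<⇒≱ m<F)
      next-small : suc i * i ! ≤ w
      next-small = ≤-trans (*-mono-≤ i<k′ (≤-trans i!≤m (<⇒≤ m<ℓ′)))
        (≤-trans (≤-reflexive (*-comm k ℓ)) ℓk≤w)
      evNext : ∀ {s} → vars s 5 ≡ + i → vars s 6 ≡ + (i !) →
        Ev s (bin mul (one+ (var 5)) (var 6)) (+ (suc i !))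
      evNext e5 e6 = evMul (evOne+ (evVar e5 (≤-trans (<⇒≤ i<k′) k≤w)) (≤-trans i<k′ k≤w))
        (evVar e6 (≤-trans i!≤m (≤-trans (<⇒≤ m<ℓ′) ℓ≤w))) next-small
      advance : Runs _ s _ Advanced
      advance = branch-≤ (evNext e5 e6) (evVar e4 (≤-trans (<⇒≤ m<F) F≤w))
        -- A single advance suffices, since `m` is at most `suc i !`, which is below the next
        -- factorial.
        (λ { (ℤ.+≤+ [1+i]!≤m) → step $ assign (evNext e5 e6) $ incr e5 (≤-trans i<k′ k≤w)
          (suc i , [1+i]!≤m , ≤-<-trans m≤[1+i]!
            (m<m+n (suc i !) (≤-trans (1≤n! (suc i)) (m≤m+n (suc i !) _))) ,
           c , e4 , refl , refl , h) })
        λ { (ℤ.+<+ m<[1+i]!) → skipᴿ (i , i!≤m , m<[1+i]! , c , e4 , e5 , e6 , h) }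

    insertRowTime : ℕ
    insertRowTime = straight insertHeader + (k * (3 + straight insertStep) + 3 + 4)

    insertRow-runs : ∀ {b m s} → m < F → Table b m s → Runs insertRow s insertRowTime (Table b (suc m))
    insertRow-runs {b} {m} m<F t = insertHeader-runs m<F t ⨾ᴿ
      λ { (i , i!≤m , m<[1+i]! , R) →
        for k (Row b m i) (λ q≤k ((e0 , _) , e3 , _) → evVar e3 (≤-trans q≤k k≤w) , evVar e0 k≤w)
          (insertStep-runs i!≤m m<[1+i]! m<F) 0 z≤n R ⨾ᴿ
        λ { {s} (c , _ , e4 , e5 , e6 , _ , _ , h) → incr e4 (≤-trans m<F F≤w)
          (c , refl , (i , e5 , e6 , m≤n⇒m≤1+n i!≤m , m<[1+i]!) ,
           subst (Filled (arrs s 1)) (trans (+-comm (k * m) k) (sym (*-suc k m))) h) } }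

    tableTime : ℕ
    tableTime = 2 + (k * (3 + straight identityStep) + 3) + (6 + ((F ∸ 1) * (3 + insertRowTime) + 3))

    table-runs : ∀ {b s} → Common b s → Runs table s tableTime (Table b F)
    table-runs {b} c = identityRow-runs c ⨾ᴿ λ { {s} (c , _ , h) →
      step $ assign (evLit 1≤w) $ step $ assign (evLit 1≤w) $ step $ assign (evLit 1≤w) $
      for F (Table b) (λ m≤F ((_ , _ , e2 , _) , e4 , _) → evVar e4 (≤-trans m≤F F≤w) , evVar e2 F≤w)
        insertRow-runs 1 (1≤n! k)
        (c , refl , (1 , refl , refl , ≤-refl , s≤s z≤n) ,
          subst (Filled (arrs s 1)) (sym (*-identityʳ k)) h) }

    -- Sorting, adding up and copying the columns

    searchTime insertEntryTime sortColumnTime addColumnTime columnTime columnsTime copyTime : ℕ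
    searchTime      = 4 + (suc ⌊log₂ k ⌋ * (3 + straight searchStep) + 3)
    insertEntryTime = searchTime + 16
    sortColumnTime  = 6 + (k * (3 + insertEntryTime) + 3)
    addColumnTime   = 2 + (k * (3 + straight addStep) + 3)
    columnTime      = sortColumnTime + (addColumnTime + 4)
    columnsTime     = 2 + (ℓ * (3 + columnTime) + 3)
    copyTime        = 2 + (k * F * (5 + straight copyStep) + 5 + 2)

    module Columns (T : ℕ → ℤ) (T-filled : Filled T (k * F)) where

      col : ℕ → ℕ → ℤ
      col j r = a (ℓ * r + j)

      Env : (ℕ → ℤ) → ℕ → State → Set
      Env b j s = Common b s × vars s 4 ≡ + j × arrs s 1 ≡ T

      Env′ : (ℕ → ℤ) → (j i n : ℕ) → State → Set
      Env′ b j i n s = Env b j s × vars s 3 ≡ + i × vars s 5 ≡ + (i !) × vars s 6 ≡ + n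

      evEntry : ∀ {b j s e r} → Env b j s → j < ℓ → Ev s e (+ r) → r < k →
        Ev s (0 [ entry e (var 4) ]) (col j r)
      evEntry {j = j} {s} {r = r} ((_ , e1 , _ , refl , _) , e4 , _) j<ℓ e r<k = evRead
        (evAdd (evMul (evVar {s = s} e1 ℓ≤w) e (≤-trans (m≤m+n (ℓ * r) j) entry≤w))
          (evVar e4 (≤-trans (<⇒≤ j<ℓ) ℓ≤w)) entry≤w)
        refl (a≤w _)
        where
        entry≤w : ℓ * r + j ≤ w
        entry≤w = ≤-trans (<⇒≤ (flat< r<k j<ℓ)) ℓk≤w

      module _ {b : ℕ → ℤ} {j} (j<ℓ : j < ℓ) where

        module _ {i n} (i<k : i < k) (n<i! : n < i !) (sorted : SortedAlong (perm i n) i (col j)) where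

          Below Above : ℕ → Set
          Below p = ∀ q → q < p → col j (perm i n q) ℤ.≤ col j i
          Above p = ∀ q → p ≤ q → q < i → col j i ℤ.≤ col j (perm i n q)

          -- The candidates for the insertion position are `lo`, ..., `lo + d`. Keeping the length
          -- instead of the right end makes halving a statement about `d` alone, and `d < 2 ^ fuel`
          -- turns it into an iteration count.
          Searching : ℕ → State → Set
          Searching fuel s = ∃[ lo ] ∃[ d ] lo + d ≤ i × d < 2 ^ fuel × Below lo × Above (lo + d) ×
            Env′ b j i n s × vars s 7 ≡ + lo × vars s 8 ≡ + d

          Found : State → Set
          Found s = ∃[ p ] p ≤ i × Below p × Above p × Env′ b j i n s × vars s 7 ≡ + p

          i≤w : i ≤ w
          i≤w = ≤-trans (<⇒≤ i<k) k≤w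

          n<F : n < F
          n<F = <-≤-trans n<i! (!-mono-≤ (<⇒≤ i<k))

          n<ℓ : n < ℓ
          n<ℓ = <-trans n<F k!<ℓ

          evPerm : ∀ {s e q} → Env b j s → vars s 6 ≡ + n → Ev s e (+ q) → q < i →
            Ev s (1 [ cell (var 6) e ]) (+ perm i n q)
          evPerm {s} {q = q} ((e0 , _) , _ , refl) e6 e q<i = evRead
            (evCell e0 (evVar {s = s} e6 (≤-trans (<⇒≤ n<ℓ) ℓ≤w)) e n<ℓ q<k)
            -- The row was tabulated for all `k` elements; as `n < i !`, its first `i` cells are the
            -- arrangement of the current stage.
            (trans (T-filled _ (flat< n<F q<k))
              (trans (tableEntry-flat n q<k) (cong +_ (perm-stable n n<i! (<⇒≤ i<k) q))))
            (≤-trans (<⇒≤ (<-trans (perm-< i n q<i) i<k)) k≤w)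
            where q<k = <-trans q<i i<k

          searchStep-runs : ∀ {fuel lo d s} → lo + d ≤ i → d < 2 ^ suc fuel → Below lo → Above (lo + d) →
            Env′ b j i n s → vars s 7 ≡ + lo → vars s 8 ≡ + d → 0 < d →
            Runs searchStep s (straight searchStep) (Searching fuel)
          searchStep-runs {fuel} {lo} {d} lo+d≤i d<2^ below above (E , e3 , e5 , e6) e7 e8 0<d =
            step $ assign (evDiv (evVar e8 d≤w) (evLit 2≤w)) $
            branch-≤
              (evEntry {b} E j<ℓ (evPerm E e6
                (evAdd (evVar e7 lo≤w) (evVar refl h≤w) (≤-trans (<⇒≤ mid<i) i≤w)) mid<i)
                  (<-trans (perm-< i n mid<i) i<k))
              (evEntry {b} E j<ℓ (evVar e3 i≤w) i<k)
              (λ mid≤ →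
                step $ assign (evAdd (evVar e7 lo≤w) (evOne+ (evVar refl h≤w) (≤-trans h<d d≤w))
                  (≤-trans mid<i′ i≤w)) $
                assign (evSub (evVar e8 d≤w) (evOne+ (evVar refl h≤w) (≤-trans h<d d≤w)) h<d)
                (lo + suc h , d ∸ suc h ,
                 subst (_≤ i) (sym same-end) lo+d≤i ,
                 ≤-<-trans d∸h≤h h<2^ ,
                 (λ q q<lo′ → ℤ.≤-trans (sorted q (lo + h)
                   (≤-pred (subst (q <_) (+-suc lo h) q<lo′)) mid<i) mid≤) ,
                 (λ q → subst (λ p → p ≤ q → q < i → col j i ℤ.≤ col j (perm i n q)) (sym same-end)
                   (above q)) ,
                 (E , e3 , e5 , e6) , refl , refl))
              (λ mid> → assign (evVar refl h≤w)
                (lo , h , <⇒≤ mid<i , h<2^ , below ,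
                 (λ q mid≤q q<i → ℤ.≤-trans (ℤ.<⇒≤ mid>) (sorted (lo + h) q mid≤q q<i)) ,
                 (E , e3 , e5 , e6) , e7 , refl))
            where
            h = d / 2
            h<d : h < d
            h<d = m/n<m d 2 {{>-nonZero 0<d}} ≤-refl
            mid<i : lo + h < i
            mid<i = <-≤-trans (+-monoʳ-< lo h<d) lo+d≤i
            mid<i′ : lo + suc h ≤ i
            mid<i′ = subst (_≤ i) (sym (+-suc lo h)) mid<i
            d≤w : d ≤ w
            d≤w = ≤-trans (≤-trans (m≤n+m d lo) lo+d≤i) i≤w
            lo≤w : lo ≤ w
            lo≤w = ≤-trans (≤-trans (m≤m+n lo d) lo+d≤i) i≤w
            h≤w : h ≤ w
            h≤w = ≤-trans (<⇒≤ h<d) d≤w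
            h<2^ : h < 2 ^ fuel
            h<2^ = m<n*o⇒m/o<n (subst (d <_) (*-comm 2 (2 ^ fuel)) d<2^)
            same-end : lo + suc h + (d ∸ suc h) ≡ lo + d
            same-end = trans (+-assoc lo (suc h) _) (cong (λ m → lo + m) (m+[n∸m]≡n h<d))
            -- As `d ≤ 2h + 1`, the part to the right of the midpoint is no longer than the part to
            -- its left.
            d∸h≤h : d ∸ suc h ≤ h
            d∸h≤h = m≤n+o⇒m∸n≤o d (suc h) (begin
              d             ≡⟨ m≡m%n+[m/n]*n d 2 ⟩
              d % 2 + h * 2 ≤⟨ +-mono-≤ (≤-pred (m%n<n d 2))
                (≤-reflexive (trans (*-comm h 2) (cong (λ m → h + m) (+-identityʳ h)))) ⟩
              suc h + h     ∎)
              where open ≤-Reasoning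

          search-runs : ∀ {s} → Env′ b j i n s → Runs search s searchTime Found
          search-runs (E , e3 , e5 , e6) =
            step $ assign (evLit z≤n) $ step $ assign (evVar e3 i≤w) $
            while< Searching next (suc ⌊log₂ k ⌋)
              (0 , i , ≤-refl , <-trans i<k (n<2^[1+⌊log₂n⌋] k) , (λ _ ()) ,
                (λ q i≤q q<i → contradiction q<i (≤⇒≯ i≤q)) ,
               (E , e3 , e5 , e6) , refl , refl)
            where
            next : ∀ {fuel s} → Searching fuel s → ∃[ y ] ∃[ z ] Ev s (lit (+ 0)) y × Ev s (var 8) z ×
              (y ℤ.< z → ∃[ m ] fuel ≡ suc m × Runs searchStep s (straight searchStep)
                (Searching m)) × (z ℤ.≤ y → Found s)
            next {fuel} {s} (lo , d , lo+d≤i , d< , below , above , E , e7 , e8) = _ , _ , evLit z≤n ,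
              evVar e8 (≤-trans (≤-trans (m≤n+m d lo) lo+d≤i) i≤w) ,
              (λ { (ℤ.+<+ 0<d) → more fuel d< 0<d }) ,
              (λ { (ℤ.+≤+ z≤n) → lo , subst (_≤ i) (+-identityʳ lo) lo+d≤i , below ,
                subst Above (+-identityʳ lo) above , E , e7 })
              where
              more : ∀ fuel → d < 2 ^ fuel → 0 < d →
                ∃[ m ] fuel ≡ suc m × Runs searchStep s (straight searchStep) (Searching m)
              more zero       d<1 0<d = contradiction d<1 (≤⇒≯ 0<d)
              more (suc fuel) d<  0<d = fuel , refl ,
                searchStep-runs {fuel} lo+d≤i d< below above E e7 e8 0<d

        Sorting : ℕ → State → Set
        Sorting i s = ∃[ n ] n < i ! × SortedAlong (perm i n) i (col j) × Env′ b j i n s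

        insertEntry-runs : ∀ {i s} → i < k → Sorting i s →
          Runs insertEntry s insertEntryTime (Sorting (suc i))
        insertEntry-runs {i} i<k (n , n<i! , sorted , E) = search-runs i<k n<i! sorted E ⨾ᴿ
          λ { {s} (p , p≤i , below , above , (E , e3 , e5 , e6) , e7) →
            let i≤w : i ≤ w
                i≤w = ≤-trans (<⇒≤ i<k) k≤w
                [1+i]!≤w : suc i ! ≤ w
                [1+i]!≤w = ≤-trans (!-mono-≤ i<k) F≤w
                i!≤w : i ! ≤ w
                i!≤w = ≤-trans (m≤m+n (i !) (i * i !)) [1+i]!≤w
                new<[1+i]! : n + (i ∸ p) * i ! < suc i !
                -- A digit of at most `i` keeps the code below `i ! + i * i !`.
                new<[1+i]! = +-mono-<-≤ n<i! (*-monoˡ-≤ (i !) (m∸n≤m i p))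
                new≤w : n + (i ∸ p) * i ! ≤ w
                new≤w = ≤-trans (<⇒≤ new<[1+i]!) [1+i]!≤w
            in
            step $ assign (evAdd (evVar e6 (≤-trans (m≤m+n n _) new≤w))
              (evMul (evSub (evVar e3 i≤w) (evVar e7 (≤-trans p≤i i≤w)) p≤i) (evVar e5 i!≤w)
                (≤-trans (m≤n+m _ n) new≤w)) new≤w) $
            step $ incr e3 (≤-trans i<k k≤w) $
            assign (evMul (evVar refl (≤-trans i<k k≤w)) (evVar e5 i!≤w) [1+i]!≤w)
            (n + (i ∸ p) * i ! , new<[1+i]! ,
             sorted-cong {c = col j} (λ q →
               trans (cong (λ p → insert i p (perm i n) q) (sym (m∸[m∸n]≡n p≤i)))
                 (sym (perm-insert i n (i ∸ p) n<i! q)))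
               (sorted-insert {perm i n} {c = col j} p≤i sorted below above) ,
             E , refl , refl , refl) }

        sortColumn-runs : ∀ {s} → Env b j s → Runs sortColumn s sortColumnTime (Sorting k)
        sortColumn-runs E =
          step $ assign (evLit z≤n) $ step $ assign (evLit 1≤w) $ step $ assign (evLit z≤n) $
          for k Sorting (λ i≤k (_ , _ , _ , ((e0 , _) , _) , e3 , _) → evVar e3 (≤-trans i≤k k≤w) ,
            evVar e0 k≤w)
            insertEntry-runs 0 z≤n
            (0 , ≤-refl , (λ _ _ _ ()) , E , refl , refl , refl)

        module _ {n} (n<F : n < F) (b≤ : ∀ r → r < k → ∣ b (F * r + n) ∣ ≤ j * M) where

          instance
            F≢0 : NonZero F
            F≢0 = k !≢0

          -- Array 2 changes during this loop, so the environment takes its current content; the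
          -- last two components relate that content to `b`, the content before the column is added.
          Adding : ℕ → State → Set
          Adding r s = Env (arrs s 2) j s × vars s 3 ≡ + r × vars s 6 ≡ + n ×
            (∀ q → q < r → arrs s 2 (F * q + n) ≡ b (F * q + n) ℤ.+ col j q) ×
            (∀ p → (∀ q → q < r → p ≢ F * q + n) → arrs s 2 p ≡ b p)

          addStep-runs : ∀ {r s} → r < k → Adding r s →
            Runs addStep s (straight addStep) (Adding (suc r))
          addStep-runs {r} {s} r<k (E@((e0 , e1 , e2 , e , _) , e4 , eT) , e3 , e6 , added , kept) =
            step $ store evIndex
              (evAdd (evRead evIndex old (≤-trans (b≤ r r<k) (≤-trans (m≤n+m (j * M) M) jM≤w)))
                (evEntry {arrs s 2} E j<ℓ ev3 r<k)
                (≤-trans (ℤ.∣i+j∣≤∣i∣+∣j∣ (b (F * r + n)) (col j r))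
                  (≤-trans (+-mono-≤ (b≤ r r<k) (a≤M _))
                    (≤-trans (≤-reflexive (+-comm (j * M) M)) jM≤w)))) $
            incr e3 (≤-trans r<k k≤w)
              (((e0 , e1 , e2 , e , refl) , e4 , eT) , refl , e6 , added′ , kept′)
            where
            jM≤w : suc j * M ≤ w
            jM≤w = ≤-trans (*-monoˡ-≤ M j<ℓ) ℓM≤w
            index≤w : F * r + n ≤ w
            index≤w = ≤-trans (<⇒≤ (flat< r<k n<F)) (≤-trans (*-monoˡ-≤ k (<⇒≤ k!<ℓ)) ℓk≤w)
            ev3 : Ev s (var 3) (+ r)
            ev3 = evVar e3 (≤-trans (<⇒≤ r<k) k≤w)
            evIndex : Ev s (bin add (bin mul (var 2) (var 3)) (var 6)) (+ (F * r + n))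
            evIndex = evAdd (evMul (evVar e2 F≤w) ev3 (≤-trans (m≤m+n (F * r) n) index≤w))
              (evVar e6 (≤-trans (<⇒≤ n<F) F≤w)) index≤w
            index≢ : ∀ {q q′} → q ≢ q′ → F * q + n ≢ F * q′ + n
            index≢ {q} {q′} q≢q′ eq = q≢q′ (*-cancelˡ-≡ q q′ F (+-cancelʳ-≡ n (F * q) (F * q′) eq))
            old : arrs s 2 (F * r + n) ≡ b (F * r + n)
            old = kept _ (λ q q<r → index≢ (<⇒≢ q<r ∘ sym))
            added′ : ∀ q → q < suc r → update (arrs s 2) (F * r + n) (b (F * r + n) ℤ.+ col j r)
              (F * q + n) ≡ b (F * q + n) ℤ.+ col j q
            added′ q q<1+r with m<1+n⇒m<n∨m≡n q<1+r
            ... | inj₂ refl = update-same (arrs s 2) (F * r + n)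
            ... | inj₁ q<r  = trans (update-other (arrs s 2) (F * r + n) (index≢ (<⇒≢ q<r)))
              (added q q<r)
            kept′ : ∀ p → (∀ q → q < suc r → p ≢ F * q + n) →
              update (arrs s 2) (F * r + n) (b (F * r + n) ℤ.+ col j r) p ≡ b p
            kept′ p p≢ = trans (update-other (arrs s 2) (F * r + n) (p≢ r ≤-refl))
              (kept p (λ q q<r → p≢ q (m<n⇒m<1+n q<r)))

          addColumn-runs : ∀ {s} → Env b j s → vars s 6 ≡ + n → Runs addColumn s addColumnTime (Adding k)
          addColumn-runs ((e0 , e1 , e2 , e , refl) , e4 , eT) e6 = step $ assign (evLit z≤n) $
            for k Adding (λ r≤k (((e0 , _) , _) , e3 , _) → evVar e3 (≤-trans r≤k k≤w) , evVar e0 k≤w)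
              addStep-runs 0 z≤n
              (((e0 , e1 , e2 , e , refl) , e4 , eT) , refl , e6 , (λ _ ()) , λ _ _ → refl)

      Merging : ℕ → State → Set
      Merging j s = Env (arrs s 2) j s × Merged k F M (λ r j → col j r) j (λ r n → arrs s 2 (F * r + n))

      column-runs : ∀ {j s} → j < ℓ → Merging j s → Runs column s columnTime (Merging (suc j))
      column-runs {j} {s₀} j<ℓ (E , I) = sortColumn-runs {arrs s₀ 2} j<ℓ E ⨾ᴿ
        λ { (n , n<F , sorted , E , _ , _ , e6) →
          addColumn-runs {arrs s₀ 2} j<ℓ n<F (λ r r<k → bounded I r n r<k n<F) E e6 ⨾ᴿ
        λ { ((c , e4 , eT) , _ , _ , added , kept) → incr e4 (≤-trans j<ℓ ℓ≤w)
          ((c , refl , eT) , merged-step I n<F sorted (λ r r<k → a≤M _) added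
            (λ r m r<k m<F m≢n → kept _ λ q q<k eq → m≢n (same-column r q m<F n<F eq))) } }
        where
        same-column : ∀ r q {m n} → m < F → n < F → F * r + m ≡ F * q + n → m ≡ n
        same-column r q m<F n<F eq = trans (sym (flat-% F r m<F))
          (trans (%-congˡ {o = F} eq) (flat-% F q n<F))
          where instance _ = k !≢0

      columns-runs : ∀ {s} → Common (λ _ → 0ℤ) s → arrs s 1 ≡ T → Runs columns s columnsTime (Merging ℓ)
      columns-runs (e0 , e1 , e2 , e , b) eT = step $ assign (evLit z≤n) $
        for ℓ Merging (λ j≤ℓ (((_ , e1 , _) , e4 , _) , _) → evVar e4 (≤-trans j≤ℓ ℓ≤w) , evVar e1 ℓ≤w)
          column-runs 0 z≤n
          (((e0 , e1 , e2 , e , refl) , refl , eT) ,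
            merged-empty (λ r n _ _ → cong (λ b → b (F * r + n)) b))

      module _ {b : ℕ → ℤ} (I : Merged k F M (λ r j → col j r) ℓ (λ r n → b (F * r + n))) where

        Copying : ℕ → State → Set
        Copying p s = vars s 0 ≡ + k × vars s 2 ≡ + F × arrs s 2 ≡ b × vars s 3 ≡ + p ×
          (∀ q → q < p → arrs s 0 q ≡ b q)

        kF≤w : k * F ≤ w
        kF≤w = ≤-trans (*-monoʳ-≤ k (<⇒≤ k!<ℓ)) (≤-trans (≤-reflexive (*-comm k ℓ)) ℓk≤w)

        b≤w : ∀ p → p < k * F → ∣ b p ∣ ≤ w
        b≤w p p<kF = ≤-trans (subst (λ p → ∣ b p ∣ ≤ ℓ * M) (sym p≡)
          (bounded I (p / F) (p % F) (m<n*o⇒m/o<n p<kF) (m%n<n p F))) ℓM≤w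
          where
          instance _ = k !≢0
          p≡ : p ≡ F * (p / F) + p % F
          p≡ = trans (m≡m%n+[m/n]*n p F) (trans (+-comm (p % F) _)
            (cong (λ m → m + p % F) (*-comm (p / F) F)))

        copyStep-runs : ∀ {p s} → p < k * F → Copying p s →
          Runs copyStep s (straight copyStep) (Copying (suc p))
        copyStep-runs {p} {s} p<kF (e0 , e2 , refl , e3 , copied) =
          step $ store (evVar e3 p≤w) (evRead (evVar e3 p≤w) refl (b≤w p p<kF)) $
            incr e3 (≤-trans p<kF kF≤w)
            (e0 , e2 , refl , refl , copied′)
          where
          p≤w : p ≤ w
          p≤w = ≤-trans (<⇒≤ p<kF) kF≤w
          copied′ : ∀ q → q < suc p → update (arrs s 0) p (arrs s 2 p) q ≡ arrs s 2 q
          copied′ q q<1+p with m<1+n⇒m<n∨m≡n q<1+p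
          ... | inj₂ refl = update-same (arrs s 0) p
          ... | inj₁ q<p  = trans (update-other (arrs s 0) p (<⇒≢ q<p)) (copied q q<p)

        copy-runs : ∀ {s} → vars s 0 ≡ + k → vars s 2 ≡ + F → arrs s 2 ≡ b →
          Runs copy s copyTime (λ s → vars s 0 ≡ + k × vars s 1 ≡ + F ×
            (∀ p → p < k * F → arrs s 0 p ≡ b p))
        copy-runs e0 e2 e = step $ assign (evLit z≤n) $
          for (k * F) Copying
            (λ p≤ (e0 , e2 , _ , e3 , _) → evVar e3 (≤-trans p≤ kF≤w) ,
              evMul (evVar e0 k≤w) (evVar e2 F≤w) kF≤w)
            copyStep-runs 0 z≤n (e0 , e2 , e , refl , λ _ ()) ⨾ᴿ
          λ { (e0 , e2 , _ , _ , copied) → assign (evVar e2 F≤w) (e0 , refl , copied) }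

-- Running time and equivalence

rowMajor-combine : ∀ {k ℓ} (A : Instance k ℓ) i j → rowMajor A (toℕ (combine i j)) ≡ A i j
rowMajor-combine {k} {ℓ} A i j with toℕ (combine i j) <? k * ℓ
... | yes p = cong (uncurry A) (trans (cong (remQuot ℓ) (fromℕ<-toℕ (combine i j) p))
  (remQuot-combine i j))
... | no ¬p = contradiction (toℕ<n (combine i j)) ¬p

rowMajor-bounded : ∀ {k ℓ M} (A : Instance k ℓ) → (∀ i j → ∣ A i j ∣ ≤ M) → ∀ p → ∣ rowMajor A p ∣ ≤ M
rowMajor-bounded {k} {ℓ} A A≤M p with p <? k * ℓ
... | yes _ = A≤M _ _
... | no _  = z≤n

dist-rowMajor : ∀ {k ℓ} (A : Instance k ℓ) (f x : ℕ → ℤ) → (∀ i j → f (toℕ (combine i j)) ≡ A i j) →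
  ∀ i → dist (x ∘ toℕ) (A i) ≡ distᴺ ℓ x (λ j → f (ℓ * toℕ i + j))
dist-rowMajor {ℓ = ℓ} A f x f≡A i = trans
  (dist-cong {x = x ∘ toℕ} (λ _ → refl) (λ j → sym (trans (cong f (sym (toℕ-combine i j))) (f≡A i j))))
  (dist≡distᴺ ℓ x (λ j → f (ℓ * toℕ i + j)))

merged⇒equivalent : ∀ {k ℓ ℓ′ M} .{{_ : NonZero k}} (A : Instance k ℓ) (B : Instance k ℓ′) f g →
  (∀ i j → f (toℕ (combine i j)) ≡ A i j) → (∀ i j → g (toℕ (combine i j)) ≡ B i j) →
  Merged k ℓ′ M (λ r j → f (ℓ * r + j)) ℓ (λ r n → g (ℓ′ * r + n)) → Equivalent A B
merged⇒equivalent A B f g f≡A g≡B I = equivalent A B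
  (λ x → let (y , h) = merge I (extend x) in y ∘ toℕ , λ i →
    subst₂ _≤_ (sym (dist-rowMajor B g y g≡B i))
      (trans (sym (dist-rowMajor A f (extend x) f≡A i)) (dist-cong (extend-toℕ x) (λ _ → refl)))
        (h (toℕ i) (toℕ<n i)))
  (λ y → let (x , h) = split I (extend y) in x ∘ toℕ , λ i →
    subst₂ _≤_ (sym (dist-rowMajor A f x f≡A i))
      (trans (sym (dist-rowMajor B g (extend y) g≡B i)) (dist-cong (extend-toℕ y) (λ _ → refl)))
        (h (toℕ i) (toℕ<n i)))

equivalent-refl : ∀ {k ℓ} .{{_ : NonZero k}} (A : Instance k ℓ) → Equivalent A A
equivalent-refl A = equivalent A A (λ x → x , λ _ → ≤-refl) (λ x → x , λ _ → ≤-refl)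

Reduced : ∀ {k ℓ} → Instance k ℓ → State → Set
Reduced {k} A s = ∃[ ℓ′ ] Σ[ A′ ∈ Instance k ℓ′ ] Output s A′ × Equivalent A A′ × ℓ′ ≤ k !

unchanged : ∀ {k ℓ} .{{_ : NonZero k}} (A : Instance k ℓ) {s} → ℓ ≤ k ! →
  vars s 0 ≡ + k → vars s 1 ≡ + ℓ → arrs s 0 ≡ rowMajor A → Reduced A s
unchanged {ℓ = ℓ} A ℓ≤k! e0 e1 e = ℓ , A ,
  record { count = e0 ; len = e1 ; entries = λ i j →
    trans (cong (λ f → f (toℕ (combine i j))) e) (rowMajor-combine A i j) } , equivalent-refl A , ℓ≤k!

-- Time bounds with computed coefficients

infix  4 _≲_
infixl 6 _+≲_

-- The coefficient is kept as data: the derivations below build it from numerals only, so it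
-- evaluates to one number for all `k`, `ℓ` and `M`.
record _≲_ (t x : ℕ) : Set where
  constructor _,_
  field
    coefficient : ℕ
    bound       : t ≤ coefficient * x

open _≲_

const≲ : ∀ c {x} → 1 ≤ x → c ≲ x
const≲ c {x} 1≤x = c , ≤-trans (≤-reflexive (sym (*-identityʳ c))) (*-monoʳ-≤ c 1≤x)

_+≲_ : ∀ {t u x} → t ≲ x → u ≲ x → t + u ≲ x
_+≲_ {x = x} (C , t≤) (D , u≤) = C + D , ≤-trans (+-mono-≤ t≤ u≤)
  (≤-reflexive (sym (*-distribʳ-+ x C D)))

_*≲_ : ∀ {m n t x} → m ≤ n → t ≲ x → m * t ≲ n * x
_*≲_ {m} {n} {t} {x} m≤n (C , t≤) = C , (begin
  m * t       ≤⟨ *-mono-≤ m≤n t≤ ⟩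
  n * (C * x) ≡⟨ *-assoc n C x ⟨
  n * C * x   ≡⟨ cong (λ m → m * x) (*-comm n C) ⟩
  C * n * x   ≡⟨ *-assoc C n x ⟩
  C * (n * x) ∎)
  where open ≤-Reasoning

≲-trans : ∀ {t x y} → t ≲ x → x ≤ y → t ≲ y
≲-trans (C , t≤) x≤y = C , ≤-trans t≤ (*-monoʳ-≤ C x≤y)

-- The coefficient of reduce≲ applied to main≲.
factor : ℕ
factor = 305

module _ (k ℓ M : ℕ) .{{_ : NonZero k}} (A : Instance k ℓ) (A≤M : ∀ i j → ∣ A i j ∣ ≤ M) where

  -- One constant serves both the time bound and the word size, which is why the time coefficient
  -- occurs here.
  w : ℕ
  w = factor * wordBound k ℓ M

  open Logic w

  wordBound≤w : wordBound k ℓ M ≤ w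
  wordBound≤w = m≤n*m (wordBound k ℓ M) factor

  ℓk≤w : ℓ * k ≤ w
  ℓk≤w = ≤-trans (*-mono-≤ (n≤1+n ℓ) (m≤m+n k M)) wordBound≤w

  ℓM≤w : ℓ * M ≤ w
  ℓM≤w = ≤-trans (*-mono-≤ (n≤1+n ℓ) (m≤n+m M k)) wordBound≤w

  1+ℓ≤w : suc ℓ ≤ w
  1+ℓ≤w = ≤-trans (≤-trans (m≤m*n (suc ℓ) k) (*-monoʳ-≤ (suc ℓ) (m≤m+n k M))) wordBound≤w

  ev1 : Ev (input A) (var 1) (+ ℓ)
  ev1 = evVar refl (≤-trans (n≤1+n ℓ) 1+ℓ≤w)

  evOne : ∀ {s} → Ev s (lit (+ 1)) (+ 1)
  evOne = evLit (≤-trans (s≤s z≤n) 1+ℓ≤w)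

  small-runs : ℓ ≤ 1 → Runs reduce (input A) 4 (Reduced A)
  small-runs ℓ≤1 = branch-≤ {B′ = 0} ev1 evOne
    (λ _ → skipᴿ (unchanged A (≤-trans ℓ≤1 (1≤n! k)) refl refl refl))
    (λ { (ℤ.+<+ 1<ℓ) → contradiction ℓ≤1 (<⇒≱ 1<ℓ) })

  module _ (1<ℓ : 1 < ℓ) where

    open Correctness k ℓ M (rowMajor A) (rowMajor-bounded A A≤M) 1<ℓ w ℓk≤w ℓM≤w

    g X : ℕ
    g = lg k
    X = ℓ * k * g

    1≤k : 1 ≤ k
    1≤k = >-nonZero⁻¹ k

    1≤g : 1 ≤ g
    1≤g = m≤m⊔n 1 ⌊log₂ k ⌋

    k≤kg : k ≤ k * g
    k≤kg = m≤m*n k g {{>-nonZero 1≤g}}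

    ℓkg≤X : ℓ * (k * g) ≤ X
    ℓkg≤X = ≤-reflexive (sym (*-assoc ℓ k g))

    ℓk≤X : ℓ * k ≤ X
    ℓk≤X = m≤m*n (ℓ * k) g {{>-nonZero 1≤g}}

    1≤ℓ : 1 ≤ ℓ
    1≤ℓ = <⇒≤ 1<ℓ

    n*1≤n : ∀ {n} → n * 1 ≤ n
    n*1≤n {n} = ≤-reflexive (*-identityʳ n)

    loop≲ : ∀ {m n} c → m ≤ n → m * c ≲ n
    loop≲ c m≤n = ≲-trans (m≤n *≲ const≲ c ≤-refl) n*1≤n

    1≤ℓk : 1 ≤ ℓ * k
    1≤ℓk = ≤-trans 1≤k k≤ℓk

    module _ (k!<ℓ : k ! < ℓ) where

      open Large k!<ℓ

      table≲ : tableTime ≲ ℓ * k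
      table≲ = ≲-trans (const≲ 2 1≤k +≲ (loop≲ _ ≤-refl +≲ const≲ 3 1≤k)) k≤ℓk +≲
        (const≲ 6 1≤ℓk +≲ (≤-trans (m∸n≤m F 1) (<⇒≤ k!<ℓ) *≲ (const≲ 3 1≤k +≲
          (const≲ (straight insertHeader) 1≤k +≲
            (loop≲ (3 + straight insertStep) ≤-refl +≲ const≲ 3 1≤k +≲ const≲ 4 1≤k)))
          +≲ const≲ 3 1≤ℓk))

      1+log≤2g : suc ⌊log₂ k ⌋ ≤ 2 * g
      1+log≤2g = +-mono-≤ 1≤g (≤-trans (m≤n⊔m 1 ⌊log₂ k ⌋) (m≤m+n g 0))

      search≲ : searchTime ≲ g
      search≲ = const≲ 4 1≤g +≲ (2*≲ (loop≲ (3 + straight searchStep) 1+log≤2g) +≲ const≲ 3 1≤g)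
        where
        2*≲ : ∀ {t x} → t ≲ 2 * x → t ≲ x
        2*≲ {x = x} (C , t≤) = C * 2 , ≤-trans t≤ (≤-reflexive (sym (*-assoc C 2 x)))

      columns≲ : columnsTime ≲ X
      columns≲ = ≲-trans
        (const≲ 2 1≤ℓkg +≲ (≤-refl {ℓ} *≲
          (const≲ 3 1≤kg +≲ (sort≲ +≲ (add≲ +≲ const≲ 4 1≤kg))) +≲ const≲ 3 1≤ℓkg)) ℓkg≤X
        where
        1≤kg : 1 ≤ k * g
        1≤kg = ≤-trans 1≤k k≤kg
        1≤ℓkg : 1 ≤ ℓ * (k * g)
        1≤ℓkg = *-mono-≤ 1≤ℓ 1≤kg
        sort≲ : sortColumnTime ≲ k * g
        sort≲ = const≲ 6 1≤kg +≲ (≤-refl {k} *≲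
          (const≲ 3 1≤g +≲ (search≲ +≲ const≲ 16 1≤g)) +≲ const≲ 3 1≤kg)
        add≲ : addColumnTime ≲ k * g
        add≲ = ≲-trans (const≲ 2 1≤k +≲ (loop≲ _ ≤-refl +≲ const≲ 3 1≤k)) k≤kg

      copy≲ : copyTime ≲ ℓ * k
      copy≲ = const≲ 2 1≤ℓk +≲ (loop≲ _ (≤-trans (*-monoʳ-≤ k (<⇒≤ k!<ℓ))
        (≤-reflexive (*-comm k ℓ))) +≲ const≲ 5 1≤ℓk +≲ const≲ 2 1≤ℓk)

      main≲ : tableTime + (columnsTime + copyTime) ≲ X
      main≲ = ≲-trans table≲ ℓk≤X +≲ (columns≲ +≲ ≲-trans copy≲ ℓk≤X)


      mainTime : ℕ
      mainTime = tableTime + (columnsTime + copyTime)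

      main-runs : ∀ {s} → vars s 0 ≡ + k → vars s 1 ≡ + ℓ → vars s 2 ≡ + F →
        arrs s 0 ≡ rowMajor A → arrs s 2 ≡ (λ _ → 0ℤ) →
          Runs (table ⨾ columns ⨾ copy) s mainTime (Reduced A)
      main-runs e0 e1 e2 eA eB = table-runs (e0 , e1 , e2 , eA , eB) ⨾ᴿ
        λ { {s₁} (c , _ , _ , filled) → Columns.columns-runs (arrs s₁ 1) filled c refl ⨾ᴿ
        λ { {s₂} (((e0 , _ , e2 , _ , _) , _) , I) → conseq (λ {s} → reduced {arrs s₂ 2} I {s})
          (Columns.copy-runs (arrs s₁ 1) filled {arrs s₂ 2} I e0 e2 refl) } }
        where
        reduced : ∀ {b} → Merged k F M (λ r j → rowMajor A (ℓ * r + j)) ℓ (λ r n → b (F * r + n)) →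
          ∀ {s} → vars s 0 ≡ + k × vars s 1 ≡ + F × (∀ p → p < k * F → arrs s 0 p ≡ b p) → Reduced A s
        reduced {b} I (e0 , e1 , copied) = F , (λ i n → b (toℕ (combine i n))) ,
          record { count = e0 ; len = e1 ; entries = λ i n → copied _ (toℕ<n (combine i n)) } ,
          merged⇒equivalent A _ (rowMajor A) b (rowMajor-combine A) (λ _ _ → refl) I , ≤-refl

    factorialTime : ℕ
    factorialTime = 4 + (k * (3 + straight factorialStep) + 3)

    factorial≲ : factorialTime ≲ X
    factorial≲ = ≲-trans (const≲ 4 1≤k +≲
      (loop≲ (3 + straight factorialStep) ≤-refl +≲ const≲ 3 1≤k)) (≤-trans k≤ℓk ℓk≤X)

    1≤X : 1 ≤ X
    1≤X = ≤-trans 1≤ℓk ℓk≤X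

    reduce≲ : ∀ {B} → B ≲ X → 3 + (factorialTime + (3 + (1 ⊔ B))) ≲ X
    reduce≲ (C , B≤) = const≲ 3 1≤X +≲ (factorial≲ +≲ (const≲ 3 1≤X +≲
      (1 + C , ≤-trans (m⊔n≤m+n 1 _) (+-mono-≤ 1≤X B≤))))

    reduce-large : ∀ {B} →
      (k ! < ℓ → ∀ {s} → vars s 0 ≡ + k → vars s 1 ≡ + ℓ → vars s 2 ≡ + (k !) → arrs s 0 ≡ rowMajor A →
        arrs s 2 ≡ (λ _ → 0ℤ) → Runs (table ⨾ columns ⨾ copy) s B (Reduced A)) →
      Runs reduce (input A) (3 + (factorialTime + (3 + (1 ⊔ B)))) (Reduced A)
    reduce-large main = branch-≤ {B = 0} ev1 evOne
      (λ { (ℤ.+≤+ ℓ≤1) → contradiction 1<ℓ (≤⇒≯ ℓ≤1) })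
      λ _ → factorial-runs {T = λ _ → 0ℤ} {λ _ → 0ℤ} refl refl (refl , refl , refl) ⨾ᴿ
      λ { {s} (e0 , e1 , _ , (eA , _ , eB) , f , e2 , f≤k! , exact , f≤ℓk) →
        branch-≤ (evVar e1 ℓ≤w) (evVar e2 (≤-trans f≤ℓk ℓk≤w))
          (λ { (ℤ.+≤+ ℓ≤f) → skipᴿ (unchanged A {s} (≤-trans ℓ≤f f≤k!) e0 e1 eA) })
          (λ { (ℤ.+<+ f<ℓ) →
            -- A product below `ℓ` was never frozen, so it is the exact factorial.
            let f≡k! = [ id , (λ ℓ≤f → contradiction f<ℓ (≤⇒≯ ℓ≤f)) ]′ exact
            in main (subst (_< ℓ) f≡k! f<ℓ) {s} e0 e1 (trans e2 (cong +_ f≡k!)) eA eB }) }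

    large-runs : Runs reduce (input A) (factor * X) (Reduced A)
    large-runs with k ! <? ℓ
    -- The coefficient is a closed numeral although `k` and `ℓ` are variables, so its comparison
    -- with `factor` is settled by evaluation.
    ... | yes k!<ℓ = weaken (≤-trans (bound (reduce≲ (main≲ k!<ℓ)))
      (*-monoˡ-≤ X (≤ᵇ⇒≤ (coefficient (reduce≲ (main≲ k!<ℓ))) factor tt)))
                       (reduce-large (λ _ {s} → main-runs k!<ℓ {s}))
    ... | no  k!≮ℓ = weaken (≤-trans (bound (reduce≲ (const≲ 0 1≤X)))
      (*-monoˡ-≤ X (≤ᵇ⇒≤ (coefficient (reduce≲ (const≲ 0 1≤X))) factor tt)))
                       (reduce-large {B = 0} (λ k!<ℓ → contradiction k!<ℓ k!≮ℓ))

  reduce-runs : Runs reduce (input A) (factor * (1 ⊔ (ℓ * k * lg k))) (Reduced A)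
  reduce-runs with ℓ ≤? 1
  ... | yes ℓ≤1 = weaken (≤-trans (≤ᵇ⇒≤ 4 factor tt)
    (m≤m*n factor (1 ⊔ (ℓ * k * lg k)) {{>-nonZero (m≤m⊔n 1 (ℓ * k * lg k))}})) (small-runs ℓ≤1)
  ... | no  ℓ≰1 = weaken (*-monoʳ-≤ factor (m≤n⊔m 1 (ℓ * k * lg k))) (large-runs (≰⇒> ℓ≰1))

theorem1 : Σ[ P ∈ Cmd ] Σ[ c ∈ ℕ ]
    ((k ℓ M : ℕ) .{{_ : NonZero k}} (A : Instance k ℓ) →
    (∀ i j → ∣ A i j ∣ ≤ M) →
    Σ[ ℓ′ ∈ ℕ ] Σ[ A′ ∈ Instance k ℓ′ ] Σ[ s ∈ State ] Σ[ t ∈ ℕ ]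
    ( (c * wordBound k ℓ M ⊢⟨ P , input A ⟩⇓[ t ] s)
    × t ≤ c * (1 ⊔ (ℓ * k * lg k))
    × Output s A′
    × Equivalent A A′
    × ℓ′ ≤ k ! ))
theorem1 = reduce , factor , λ k ℓ M A A≤M →
  let open Logic (factor * wordBound k ℓ M)
      runs run time≤ (ℓ′ , A′ , output , equivalent , ℓ′≤k!) = reduce-runs k ℓ M A A≤M
  in ℓ′ , A′ , _ , _ , run , time≤ , output , equivalent , ℓ′≤k!
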